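{- Let $ex_3(D_2^3,n)$ denote the maximum number of edges of an $n$-vertex geometric $3$-hypergraph in $3$-space that does not contain two disjoint edges. Then $ex_3(D_2^3,n)=\Theta(n^2)$ as $n\to\infty$; that is, there exist absolute constants $c,C>0$ and $n_0$ such that $c\,n^2\le ex_3(D_2^3,n)\le C\,n^2$ for all $n\ge n_0$.
   Context: A geometric $3$-hypergraph in $3$-space is a pair $H=(V,E)$, where $V$ is a finite set of points in general position in $\mathbb{R}^3$ (no four on a plane and no three on a line) and $E$ is a set of closed triangles ($2$-dimensional simplices), each being the convex hull of some $3$-element subset of $V$. $H$ is $n$-vertex if $|V|=n$. Two edges are disjoint if the corresponding closed triangles have no point in common (as subsets of $\mathbb{R}^3$). -}

module Defs where

open import Algebra.Bundles using (module CommutativeMonoid)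
import Algebra.Properties.AbelianGroup as AbelianGroupProperties
import Algebra.Properties.CommutativeSemigroup as CommutativeSemigroupProperties
open import Data.Fin.Subset using (Subset; _∉_; ∣_∣)
open import Data.List.Base using (List; []; _∷_; length)
open import Data.List.Membership.Propositional using () renaming (_∈_ to _∈ˡ_)
open import Data.List.Relation.Unary.All using (All)
open import Data.List.Relation.Unary.Unique.Propositional using (Unique)
open import Data.Integer.Base using (+_)
open import Data.Nat.Base as ℕ using (ℕ)
import Data.Nat.Properties as ℕ
open import Data.Product.Base using (Σ-syntax; ∃-syntax; _×_; _,_; proj₁; proj₂)
open import Data.Rational.Base as ℚ using (ℚ; 0ℚ; 1ℚ; ½)
import Data.Rational.Properties as ℚ
open import Data.Vec.Functional using (Vector; foldr)
open import Function.Definitions using (Injective)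
open import Relation.Binary.PropositionalEquality
  using (_≡_; sym; trans; cong; cong₂; subst; module ≡-Reasoning)
open import Relation.Nullary.Negation using (¬_)

infix  4 _≈_ _≤_ _<_ _≋_
infixl 6 _+_
infixl 7 _*_

-- Real numbers: Cauchy sequences of rationals with the setoid equality
-- "the difference tends to 0".

IsCauchy : (ℕ → ℚ) → Set
IsCauchy x = ∀ ε → 0ℚ ℚ.< ε →
  ∃[ N ] (∀ m n → N ℕ.≤ m → N ℕ.≤ n → ℚ.∣ x m ℚ.- x n ∣ ℚ.< ε)

record ℝ : Set where
  constructor mkℝ
  field
    seq    : ℕ → ℚ
    cauchy : IsCauchy seq

open ℝ public

_≈_ : ℝ → ℝ → Set
x ≈ y = ∀ ε → 0ℚ ℚ.< ε →
  ∃[ N ] (∀ n → N ℕ.≤ n → ℚ.∣ seq x n ℚ.- seq y n ∣ ℚ.< ε)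

_≤_ : ℝ → ℝ → Set
x ≤ y = ∀ ε → 0ℚ ℚ.< ε →
  ∃[ N ] (∀ n → N ℕ.≤ n → seq x n ℚ.< seq y n ℚ.+ ε)

_<_ : ℝ → ℝ → Set
x < y = Σ[ ε ∈ ℚ ] 0ℚ ℚ.< ε ×
  ∃[ N ] (∀ n → N ℕ.≤ n → seq x n ℚ.+ ε ℚ.< seq y n)

fromℚ : ℚ → ℝ
fromℚ q = mkℝ (λ _ → q)
  λ ε 0<ε → 0 , λ _ _ _ _ →
    subst (λ d → ℚ.∣ d ∣ ℚ.< ε) (sym (ℚ.+-inverseʳ q)) 0<ε

fromℕ : ℕ → ℝ
fromℕ n = fromℚ (+ n ℚ./ 1)

0ℝ 1ℝ : ℝ
0ℝ = fromℚ 0ℚ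
1ℝ = fromℚ 1ℚ

private
  module +-AG = AbelianGroupProperties ℚ.+-0-abelianGroup
  module +-CS = CommutativeSemigroupProperties
    (CommutativeMonoid.commutativeSemigroup ℚ.+-0-commutativeMonoid)
  module *-CS = CommutativeSemigroupProperties
    (CommutativeMonoid.commutativeSemigroup ℚ.*-1-commutativeMonoid)

  half-pos : ∀ {ε} → 0ℚ ℚ.< ε → 0ℚ ℚ.< ½ ℚ.* ε
  half-pos {ε} 0<ε =
    subst (ℚ._< ½ ℚ.* ε) (ℚ.*-zeroʳ ½) (ℚ.*-monoʳ-<-pos ½ 0<ε)

  half+half : ∀ ε → ½ ℚ.* ε ℚ.+ ½ ℚ.* ε ≡ ε
  half+half ε =
    trans (sym (ℚ.*-distribʳ-+ ε ½ ½)) (ℚ.*-identityˡ ε)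

  abstract
    +-cauchy : ∀ {x y} → IsCauchy x → IsCauchy y → IsCauchy (λ n → x n ℚ.+ y n)
    +-cauchy {x} {y} cx cy ε 0<ε
      with cx (½ ℚ.* ε) (half-pos 0<ε) | cy (½ ℚ.* ε) (half-pos 0<ε)
    ... | N₁ , p | N₂ , q = N₁ ℕ.⊔ N₂ , λ m n m≥ n≥ → begin-strict
      ℚ.∣ (x m ℚ.+ y m) ℚ.- (x n ℚ.+ y n) ∣
        ≡⟨ cong ℚ.∣_∣ (rearrange (x m) (y m) (x n) (y n)) ⟩
      ℚ.∣ (x m ℚ.- x n) ℚ.+ (y m ℚ.- y n) ∣
        ≤⟨ ℚ.∣p+q∣≤∣p∣+∣q∣ (x m ℚ.- x n) (y m ℚ.- y n) ⟩
      ℚ.∣ x m ℚ.- x n ∣ ℚ.+ ℚ.∣ y m ℚ.- y n ∣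
        <⟨ ℚ.+-mono-<
             (p m n (ℕ.m⊔n≤o⇒m≤o N₁ N₂ m≥) (ℕ.m⊔n≤o⇒m≤o N₁ N₂ n≥))
             (q m n (ℕ.m⊔n≤o⇒n≤o N₁ N₂ m≥) (ℕ.m⊔n≤o⇒n≤o N₁ N₂ n≥)) ⟩
      ½ ℚ.* ε ℚ.+ ½ ℚ.* ε
        ≡⟨ half+half ε ⟩
      ε ∎
      where
      open ℚ.≤-Reasoning
      rearrange : ∀ a b c d →
        (a ℚ.+ b) ℚ.- (c ℚ.+ d) ≡ (a ℚ.- c) ℚ.+ (b ℚ.- d)
      rearrange a b c d =
        trans (cong (a ℚ.+ b ℚ.+_) (ℚ.neg-distrib-+ c d))
              (+-CS.interchange a b (ℚ.- c) (ℚ.- d))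

  abstract
    eventually-bounded : ∀ {x} → IsCauchy x →
      Σ[ B ∈ ℚ ] ℚ.Positive B × ∃[ N ] (∀ n → N ℕ.≤ n → ℚ.∣ x n ∣ ℚ.≤ B)
    eventually-bounded {x} cx with cx 1ℚ (ℚ.positive⁻¹ 1ℚ)
    ... | N , p =
      ℚ.∣ x N ∣ ℚ.+ 1ℚ ,
      ℚ.nonNeg+pos⇒pos ℚ.∣ x N ∣ {{ℚ.∣-∣-nonNeg (x N)}} 1ℚ ,
      N , λ n n≥ → begin
        ℚ.∣ x n ∣
          ≡⟨ cong ℚ.∣_∣ (split (x n) (x N)) ⟩
        ℚ.∣ x N ℚ.+ (x n ℚ.- x N) ∣
          ≤⟨ ℚ.∣p+q∣≤∣p∣+∣q∣ (x N) (x n ℚ.- x N) ⟩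
        ℚ.∣ x N ∣ ℚ.+ ℚ.∣ x n ℚ.- x N ∣
          ≤⟨ ℚ.+-monoʳ-≤ ℚ.∣ x N ∣ (ℚ.<⇒≤ (p n N n≥ ℕ.≤-refl)) ⟩
        ℚ.∣ x N ∣ ℚ.+ 1ℚ ∎
      where
      open ℚ.≤-Reasoning
      split : ∀ a b → a ≡ b ℚ.+ (a ℚ.- b)
      split a b =
        sym (trans (sym (ℚ.+-assoc b a (ℚ.- b))) (+-AG.xyx⁻¹≈y b a))

  abstract
    *-cauchy : ∀ {x y} → IsCauchy x → IsCauchy y → IsCauchy (λ n → x n ℚ.* y n)
    *-cauchy {x} {y} cx cy ε 0<ε
      with eventually-bounded cx | eventually-bounded cy
    ... | A , A>0 , M₁ , ∣x∣≤A | B , B>0 , M₂ , ∣y∣≤B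
      = (M₁ ℕ.⊔ M₂) ℕ.⊔ (N₁ ℕ.⊔ N₂) , bound
      where
      instance
        pA : ℚ.Positive A
        pA = A>0
        pB : ℚ.Positive B
        pB = B>0
        pAB : ℚ.Positive (A ℚ.+ B)
        pAB = ℚ.pos+pos⇒pos A B
        nzAB : ℚ.NonZero (A ℚ.+ B)
        nzAB = ℚ.pos⇒nonZero (A ℚ.+ B)
        p1/ : ℚ.Positive (ℚ.1/ (A ℚ.+ B))
        p1/ = ℚ.1/pos⇒pos (A ℚ.+ B)
        pε : ℚ.Positive ε
        pε = ℚ.positive 0<ε
      δ : ℚ
      δ = ε ℚ.* ℚ.1/ (A ℚ.+ B)
      instance
        pδ : ℚ.Positive δ
        pδ = ℚ.pos*pos⇒pos ε (ℚ.1/ (A ℚ.+ B))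
      δ>0 : 0ℚ ℚ.< δ
      δ>0 = ℚ.positive⁻¹ δ
      N₁ N₂ : ℕ
      N₁ = proj₁ (cx δ δ>0)
      N₂ = proj₁ (cy δ δ>0)

      rearrange : ∀ a b c d →
        a ℚ.* b ℚ.- c ℚ.* d ≡ a ℚ.* (b ℚ.- d) ℚ.+ d ℚ.* (a ℚ.- c)
      rearrange a b c d = sym (begin
        a ℚ.* (b ℚ.- d) ℚ.+ d ℚ.* (a ℚ.- c)
          ≡⟨ cong₂ ℚ._+_ (expand a b d) (expand d a c) ⟩
        (a ℚ.* b ℚ.- a ℚ.* d) ℚ.+ (d ℚ.* a ℚ.- d ℚ.* c)
          ≡⟨ cong₂ (λ s t → (a ℚ.* b ℚ.- a ℚ.* d) ℚ.+ (s ℚ.- t))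
               (ℚ.*-comm d a) (ℚ.*-comm d c) ⟩
        (a ℚ.* b ℚ.- a ℚ.* d) ℚ.+ (a ℚ.* d ℚ.- c ℚ.* d)
          ≡⟨ telescope (a ℚ.* b) (a ℚ.* d) (c ℚ.* d) ⟩
        a ℚ.* b ℚ.- c ℚ.* d ∎)
        where
        open ≡-Reasoning
        expand : ∀ p q r → p ℚ.* (q ℚ.- r) ≡ p ℚ.* q ℚ.- p ℚ.* r
        expand p q r = trans (ℚ.*-distribˡ-+ p q (ℚ.- r))
          (cong (p ℚ.* q ℚ.+_) (sym (ℚ.neg-distribʳ-* p r)))
        telescope : ∀ p q r → (p ℚ.- q) ℚ.+ (q ℚ.- r) ≡ p ℚ.- r
        telescope p q r = trans (ℚ.+-assoc p (ℚ.- q) (q ℚ.- r))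
          (cong (p ℚ.+_) (trans (sym (ℚ.+-assoc (ℚ.- q) q (ℚ.- r)))
            (trans (cong (ℚ._- r) (ℚ.+-inverseˡ q)) (ℚ.+-identityˡ (ℚ.- r)))))

      total : A ℚ.* δ ℚ.+ B ℚ.* δ ≡ ε
      total = trans (factor A B ε (ℚ.1/ (A ℚ.+ B)))
        (trans (cong (ε ℚ.*_) (ℚ.*-inverseʳ (A ℚ.+ B))) (ℚ.*-identityʳ ε))
        where
        factor : ∀ a b e i →
          a ℚ.* (e ℚ.* i) ℚ.+ b ℚ.* (e ℚ.* i) ≡ e ℚ.* ((a ℚ.+ b) ℚ.* i)
        factor a b e i = trans (sym (ℚ.*-distribʳ-+ (e ℚ.* i) a b))
          (*-CS.x∙yz≈y∙xz (a ℚ.+ b) e i)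

      term : ∀ K p q .{{_ : ℚ.Positive K}} →
        ℚ.∣ p ∣ ℚ.≤ K → ℚ.∣ q ∣ ℚ.< δ → ℚ.∣ p ℚ.* q ∣ ℚ.< K ℚ.* δ
      term K p q ∣p∣≤K ∣q∣<δ = begin-strict
        ℚ.∣ p ℚ.* q ∣          ≡⟨ ℚ.∣p*q∣≡∣p∣*∣q∣ p q ⟩
        ℚ.∣ p ∣ ℚ.* ℚ.∣ q ∣
          ≤⟨ ℚ.*-monoʳ-≤-nonNeg ℚ.∣ q ∣ {{ℚ.∣-∣-nonNeg q}} ∣p∣≤K ⟩
        K ℚ.* ℚ.∣ q ∣          <⟨ ℚ.*-monoʳ-<-pos K ∣q∣<δ ⟩
        K ℚ.* δ                ∎
        where open ℚ.≤-Reasoning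

      bound : ∀ m n →
        (M₁ ℕ.⊔ M₂) ℕ.⊔ (N₁ ℕ.⊔ N₂) ℕ.≤ m →
        (M₁ ℕ.⊔ M₂) ℕ.⊔ (N₁ ℕ.⊔ N₂) ℕ.≤ n →
        ℚ.∣ x m ℚ.* y m ℚ.- x n ℚ.* y n ∣ ℚ.< ε
      bound m n m≥ n≥ = begin-strict
        ℚ.∣ x m ℚ.* y m ℚ.- x n ℚ.* y n ∣
          ≡⟨ cong ℚ.∣_∣ (rearrange (x m) (y m) (x n) (y n)) ⟩
        ℚ.∣ x m ℚ.* (y m ℚ.- y n) ℚ.+ y n ℚ.* (x m ℚ.- x n) ∣
          ≤⟨ ℚ.∣p+q∣≤∣p∣+∣q∣ (x m ℚ.* (y m ℚ.- y n)) (y n ℚ.* (x m ℚ.- x n)) ⟩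
        ℚ.∣ x m ℚ.* (y m ℚ.- y n) ∣ ℚ.+ ℚ.∣ y n ℚ.* (x m ℚ.- x n) ∣
          <⟨ ℚ.+-mono-<
               (term A (x m) (y m ℚ.- y n) (∣x∣≤A m (M≥₁ m≥))
                 (proj₂ (cy δ δ>0) m n (N≥₂ m≥) (N≥₂ n≥)))
               (term B (y n) (x m ℚ.- x n) (∣y∣≤B n (M≥₂ n≥))
                 (proj₂ (cx δ δ>0) m n (N≥₁ m≥) (N≥₁ n≥))) ⟩
        A ℚ.* δ ℚ.+ B ℚ.* δ
          ≡⟨ total ⟩
        ε ∎
        where
        open ℚ.≤-Reasoning
        M≥ : ∀ {k} → (M₁ ℕ.⊔ M₂) ℕ.⊔ (N₁ ℕ.⊔ N₂) ℕ.≤ k → M₁ ℕ.⊔ M₂ ℕ.≤ k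
        M≥ = ℕ.m⊔n≤o⇒m≤o (M₁ ℕ.⊔ M₂) (N₁ ℕ.⊔ N₂)
        N≥ : ∀ {k} → (M₁ ℕ.⊔ M₂) ℕ.⊔ (N₁ ℕ.⊔ N₂) ℕ.≤ k → N₁ ℕ.⊔ N₂ ℕ.≤ k
        N≥ = ℕ.m⊔n≤o⇒n≤o (M₁ ℕ.⊔ M₂) (N₁ ℕ.⊔ N₂)
        M≥₁ : ∀ {k} → (M₁ ℕ.⊔ M₂) ℕ.⊔ (N₁ ℕ.⊔ N₂) ℕ.≤ k → M₁ ℕ.≤ k
        M≥₁ h = ℕ.m⊔n≤o⇒m≤o M₁ M₂ (M≥ h)
        M≥₂ : ∀ {k} → (M₁ ℕ.⊔ M₂) ℕ.⊔ (N₁ ℕ.⊔ N₂) ℕ.≤ k → M₂ ℕ.≤ k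
        M≥₂ h = ℕ.m⊔n≤o⇒n≤o M₁ M₂ (M≥ h)
        N≥₁ : ∀ {k} → (M₁ ℕ.⊔ M₂) ℕ.⊔ (N₁ ℕ.⊔ N₂) ℕ.≤ k → N₁ ℕ.≤ k
        N≥₁ h = ℕ.m⊔n≤o⇒m≤o N₁ N₂ (N≥ h)
        N≥₂ : ∀ {k} → (M₁ ℕ.⊔ M₂) ℕ.⊔ (N₁ ℕ.⊔ N₂) ℕ.≤ k → N₂ ℕ.≤ k
        N≥₂ h = ℕ.m⊔n≤o⇒n≤o N₁ N₂ (N≥ h)

_+_ : ℝ → ℝ → ℝ
x + y = mkℝ (λ n → seq x n ℚ.+ seq y n) (+-cauchy {seq x} {seq y} (cauchy x) (cauchy y))

_*_ : ℝ → ℝ → ℝ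
x * y = mkℝ (λ n → seq x n ℚ.* seq y n) (*-cauchy {seq x} {seq y} (cauchy x) (cauchy y))

sum : ∀ {n} → Vector ℝ n → ℝ
sum = foldr _+_ 0ℝ

ℝ³ : Set
ℝ³ = Vector ℝ 3

_≋_ : ℝ³ → ℝ³ → Set
x ≋ y = ∀ k → x k ≈ y k

𝟎 : ℝ³
𝟎 _ = 0ℝ

dot : ℝ³ → ℝ³ → ℝ
dot u x = sum (λ k → u k * x k)

Collinear : List ℝ³ → Set
Collinear xs = Σ[ a ∈ ℝ³ ] Σ[ d ∈ ℝ³ ] ¬ (d ≋ 𝟎) ×
  All (λ x → Σ[ t ∈ ℝ ] x ≋ (λ k → a k + t * d k)) xs

Coplanar : List ℝ³ → Set
Coplanar xs = Σ[ u ∈ ℝ³ ] Σ[ h ∈ ℝ ] ¬ (u ≋ 𝟎) ×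
  All (λ x → dot u x ≈ h) xs

record GeneralPosition {n} (p : Vector ℝ³ n) : Set where
  field
    distinct          : Injective _≡_ _≋_ p
    no-three-on-line  : ∀ i j k → Unique (i ∷ j ∷ k ∷ []) →
                        ¬ Collinear (p i ∷ p j ∷ p k ∷ [])
    no-four-on-plane  : ∀ i j k l → Unique (i ∷ j ∷ k ∷ l ∷ []) →
                        ¬ Coplanar (p i ∷ p j ∷ p k ∷ p l ∷ [])

-- The convex hull of { p i ∣ i ∈ S }, as a predicate on points: the weights
-- range over all of Fin n but vanish off S.
ConvexHull : ∀ {n} → Vector ℝ³ n → Subset n → ℝ³ → Set
ConvexHull {n} p S x = Σ[ w ∈ Vector ℝ n ]
  (∀ i → 0ℝ ≤ w i) ×
  (∀ i → i ∉ S → w i ≈ 0ℝ) ×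
  sum w ≈ 1ℝ ×
  (∀ k → x k ≈ sum (λ i → w i * p i k))

-- In general position a triangle determines its three vertices, so a set of
-- triangles is encoded as a repetition-free list of 3-element vertex sets.
record GeometricHypergraph (n : ℕ) : Set where
  field
    point            : Vector ℝ³ n
    general-position : GeneralPosition point
    edges            : List (Subset n)
    edges-unique     : Unique edges
    edges-triples    : All (λ e → ∣ e ∣ ≡ 3) edges

  triangle : Subset n → ℝ³ → Set
  triangle = ConvexHull point

  DisjointEdges : Subset n → Subset n → Set
  DisjointEdges e f = ∀ x → ¬ (triangle e x × triangle f x)

  HasTwoDisjointEdges : Set
  HasTwoDisjointEdges =
    ∃[ e ] ∃[ f ] e ∈ˡ edges × f ∈ˡ edges × DisjointEdges e f

open GeometricHypergraph public

IsMaximum : (ℕ → Set) → ℕ → Set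
IsMaximum P m = P m × (∀ k → P k → k ℕ.≤ m)

-- Isex₃D₂ n m : "ex₃(D₂³, n) = m".  The number ex₃(D₂³, n) is introduced
-- through its graph because the maximum, although it exists classically,
-- is not given by a constructive function of n.
Isex₃D₂ : ℕ → ℕ → Set
Isex₃D₂ n = IsMaximum λ m →
  Σ[ H ∈ GeometricHypergraph n ] ¬ HasTwoDisjointEdges H × length (edges H) ≡ m

{-# OPTIONS --safe #-}

-- Lower bound: all triangles through one vertex of the moment curve.
--
-- Upper bound 2n², by two rounds of marking in the spirit of the proof that a plane
-- geometric graph without disjoint edges has at most n edges.  For every ordered pair
-- (i , j) mark the triangle ijx last in the rotation about the line ij, that is, with no
-- triangle ijy such that orient i j x y > 0.  Among the triangles vab with highest
-- vertex v that are not marked at (a , b), mark for every (v , a) the last one likewise.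
-- There is at most one mark of each kind for each pair.  A triangle vab escaping all
-- marks has successors vac and vbd with orient v a b c > 0 and orient v b a d > 0.  As
-- v is the highest of the five points, it is not interior to the tetrahedron abcd, so b
-- and d lie strictly on one side of the plane vac, or a and c on one side of vbd.  In
-- the first case some triangle acw has w strictly on the other side, and then acw and
-- vbd are disjoint; the second case is symmetric.
--
-- Signs of reals are decided under a double negation, since the bound is stable.
module Submission where

open import Defs
open import Data.Nat.Base as ℕ using (ℕ)
open import Data.Product.Base using (Σ-syntax; ∃-syntax; _×_)
open import Relation.Nullary.Negation using (¬_)
import Data.Bool.Properties as Bool
open import Data.Fin.Base using (Fin; zero; suc; toℕ; combine; remQuot)
open import Data.Fin.Patterns using (0F; 1F; 2F; 3F; 4F)
open import Data.Fin.Properties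
  using (any?; combine-injective; suc-injective; injective⇒≤; toℕ-injective; ∀-cons)
  renaming (_≟_ to _≟ᶠ_)
open import Data.Fin.Subset
  using (Subset; _∈_; _∉_; ∣_∣; ⁅_⁆; _∪_; inside; outside) renaming (⊥ to ∅)
open import Data.Fin.Subset.Properties
  using (_∈?_; x∈p∪q⁻; x∈⁅y⁆⇒x≡y; ∪-comm; ∪-assoc; ∪-identityˡ; ∣⊥∣≡0)
open import Data.Integer.Base as ℤ using (+_)
import Data.Integer.Properties as ℤ
open import Data.List.Base using (List; []; _∷_; length; lookup; map; _++_)
import Data.List.Membership.DecPropositional as DecMembership
open import Data.List.Membership.Propositional using () renaming (_∈_ to _∈ˡ_)
open import Data.List.Membership.Propositional.Properties using (∈-lookup; ∈-map⁻)
open import Data.List.Properties using (length-++; length-map)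
open import Data.List.Relation.Unary.All as All using (All; []; _∷_)
import Data.List.Relation.Unary.All.Properties as All
open import Data.List.Relation.Unary.AllPairs using ([]; _∷_)
open import Data.List.Relation.Unary.Unique.Propositional using (Unique)
import Data.List.Relation.Unary.Unique.Propositional.Properties as Unique
open import Data.Nat.Base using (zero; suc; s≤s)
import Data.Nat.Properties as ℕ
open import Data.Nat.Tactic.RingSolver using (solve-∀)
open import Data.Product.Base using (_,_; proj₂)
open import Data.Rational.Base as ℚ using (ℚ; 0ℚ; 1ℚ; ½)
import Data.Rational.Properties as ℚ
open import Data.Rational.Solver using (module +-*-Solver)
open import Data.Rational.Unnormalised.Base as ℚᵘ using (mkℚᵘ; *≤*)
import Data.Rational.Unnormalised.Properties as ℚᵘ
open import Data.Sum.Base using (_⊎_; inj₁; inj₂)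
open import Data.Vec.Base using (Vec; []; _∷_; tabulate; here)
open import Data.Vec.Functional using (Vector) renaming ([] to []ᵛ; _∷_ to _∷ᵛ_)
open import Data.Vec.Properties using (≡-dec; ∷-injectiveʳ)
open import Function.Base using (_∘_; id)
open import Level using (0ℓ)
open import Relation.Binary.Bundles using (Setoid)
open import Relation.Binary.PropositionalEquality
  using (_≡_; _≢_; refl; sym; trans; cong; cong₂; subst; subst₂; ≢-sym)
import Relation.Binary.Reasoning.Setoid as SetoidReasoning
open import Relation.Nullary.Decidable
  using (Dec; yes; no; _×-dec_; ¬?; decidable-stable; ¬¬-excluded-middle)
open import Relation.Nullary.Negation using (contradiction)

open +-*-Solver
  using (Polynomial; solve; prove; con; var; ⟦_⟧; ⟦_⟧↓; _:=_; _:+_; _:*_; _:-_; :-_)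

-- Cauchy reals

-1ℚ : ℚ
-1ℚ = ℚ.- 1ℚ

-- Many estimates below are proved as positivity of a difference: the ring solver rewrites the
-- difference as a sum or product of quantities already known to be positive.
p<q⇒0<q-p : ∀ {p q} → p ℚ.< q → 0ℚ ℚ.< q ℚ.- p
p<q⇒0<q-p {p} {q} p<q =
  subst (ℚ._< q ℚ.- p) (ℚ.+-inverseʳ p) (ℚ.+-monoˡ-< (ℚ.- p) p<q)

0<q-p⇒p<q : ∀ {p q} → 0ℚ ℚ.< q ℚ.- p → p ℚ.< q
0<q-p⇒p<q {p} {q} 0<q-p = ℚ.≤-<-trans (ℚ.≤-reflexive (sym (ℚ.+-identityʳ p)))
  (ℚ.<-≤-trans (ℚ.+-monoʳ-< p 0<q-p)
    (ℚ.≤-reflexive (solve 2 (λ p q → p :+ (q :- p) := q) refl p q)))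

0<p+q : ∀ {p q} → 0ℚ ℚ.< p → 0ℚ ℚ.< q → 0ℚ ℚ.< p ℚ.+ q
0<p+q = ℚ.+-mono-<

0<p*q : ∀ {p q} → 0ℚ ℚ.< p → 0ℚ ℚ.< q → 0ℚ ℚ.< p ℚ.* q
0<p*q {p} {q} 0<p 0<q = ℚ.positive⁻¹ (p ℚ.* q)
  {{ℚ.pos*pos⇒pos p {{ℚ.positive 0<p}} q {{ℚ.positive 0<q}}}}

half : ℚ → ℚ
half ε = ½ ℚ.* ε

0<half : ∀ {ε} → 0ℚ ℚ.< ε → 0ℚ ℚ.< half ε
0<half = 0<p*q (ℚ.positive⁻¹ ½)

half+half : ∀ ε → half ε ℚ.+ half ε ≡ ε
half+half = solve 1 (λ ε → con ½ :* ε :+ con ½ :* ε := ε) refl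

p≤∣p∣ : ∀ p → p ℚ.≤ ℚ.∣ p ∣
p≤∣p∣ p with ℚ.≤-total 0ℚ p
... | inj₁ 0≤p = ℚ.≤-reflexive (sym (ℚ.0≤p⇒∣p∣≡p 0≤p))
... | inj₂ p≤0 = ℚ.≤-trans p≤0 (ℚ.0≤∣p∣ p)

∣p-q∣≡∣q-p∣ : ∀ p q → ℚ.∣ p ℚ.- q ∣ ≡ ℚ.∣ q ℚ.- p ∣
∣p-q∣≡∣q-p∣ p q = trans (sym (ℚ.∣-p∣≡∣p∣ (p ℚ.- q)))
  (cong ℚ.∣_∣ (solve 2 (λ p q → :- (p :- q) := q :- p) refl p q))

∣p∣<ε⇒0<ε-p : ∀ {p ε} → ℚ.∣ p ∣ ℚ.< ε → 0ℚ ℚ.< ε ℚ.- p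
∣p∣<ε⇒0<ε-p {p} h = p<q⇒0<q-p (ℚ.≤-<-trans (p≤∣p∣ p) h)

∣p∣<ε⇒0<ε+p : ∀ {p ε} → ℚ.∣ p ∣ ℚ.< ε → 0ℚ ℚ.< ε ℚ.+ p
∣p∣<ε⇒0<ε+p {p} {ε} h = subst (0ℚ ℚ.<_)
  (solve 2 (λ ε p → ε :- (:- p) := ε :+ p) refl ε p)
  (∣p∣<ε⇒0<ε-p {ℚ.- p} (subst (ℚ._< ε) (sym (ℚ.∣-p∣≡∣p∣ p)) h))

0<ε±p⇒∣p∣<ε : ∀ {p ε} → 0ℚ ℚ.< ε ℚ.- p → 0ℚ ℚ.< ε ℚ.+ p → ℚ.∣ p ∣ ℚ.< ε
0<ε±p⇒∣p∣<ε {p} {ε} u l with ℚ.∣p∣≡p∨∣p∣≡-p p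
... | inj₁ e = subst (ℚ._< ε) (sym e) (0<q-p⇒p<q u)
... | inj₂ e = subst (ℚ._< ε) (sym e)
  (0<q-p⇒p<q (subst (0ℚ ℚ.<_) (solve 2 (λ ε p → ε :+ p := ε :- (:- p)) refl ε p) l))

-- Properties of the tail of a sequence

Eventually : (ℕ → Set) → Set
Eventually P = ∃[ N ] (∀ n → N ℕ.≤ n → P n)

eventually-map : ∀ {P Q : ℕ → Set} → (∀ n → P n → Q n) → Eventually P → Eventually Q
eventually-map f (N , p) = N , λ n N≤n → f n (p n N≤n)

eventually-zip : ∀ {P Q R : ℕ → Set} → (∀ n → P n → Q n → R n) →
  Eventually P → Eventually Q → Eventually R
eventually-zip f (M , p) (N , q) = M ℕ.⊔ N , λ n M⊔N≤n →
  f n (p n (ℕ.m⊔n≤o⇒m≤o M N M⊔N≤n)) (q n (ℕ.m⊔n≤o⇒n≤o M N M⊔N≤n))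

bounded : ∀ x → Σ[ B ∈ ℚ ] 0ℚ ℚ.< B × Eventually (λ n → ℚ.∣ seq x n ∣ ℚ.< B)
bounded x = let N , close = cauchy x 1ℚ (ℚ.positive⁻¹ 1ℚ) ; y = seq x N in
  ℚ.∣ y ∣ ℚ.+ 1ℚ , ℚ.+-mono-≤-< (ℚ.0≤∣p∣ y) (ℚ.positive⁻¹ 1ℚ) ,
  N , λ n N≤n → ℚ.≤-<-trans
    (ℚ.≤-trans
      (ℚ.≤-reflexive (cong ℚ.∣_∣ (solve 2 (λ p q → p := q :+ (p :- q)) refl (seq x n) y)))
      (ℚ.∣p+q∣≤∣p∣+∣q∣ y (seq x n ℚ.- y)))
    (ℚ.+-monoʳ-< ℚ.∣ y ∣ (close n N N≤n ℕ.≤-refl))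

-- Record wrappers around the relations of Defs, from which Agda can infer the
-- reals involved.
record _≃_ (x y : ℝ) : Set where
  constructor mk≃
  field un≃ : x ≈ y

record Pos (x : ℝ) : Set where
  constructor pos
  field unPos : 0ℝ < x

record NonNeg (x : ℝ) : Set where
  constructor nonNeg
  field unNonNeg : 0ℝ ≤ x

open _≃_
open Pos
open NonNeg

infix 4 _≃_
infix 8 -_
infixl 6 _-_

-- Negation as a product with the constant -1 needs no Cauchy proof of its own and inherits
-- congruence from `*-congˡ`.
-_ : ℝ → ℝ
- x = fromℚ -1ℚ * x

_-_ : ℝ → ℝ → ℝ
x - y = x + - y

-- Sums and products are formed termwise, so this reduces algebraic identities between reals to
-- rational identities at each index.
pointwise : ∀ {x y} → (∀ n → seq x n ≡ seq y n) → x ≃ y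
pointwise {x} {y} eq = mk≃ λ ε 0<ε → 0 , λ n _ → subst (λ d → ℚ.∣ d ∣ ℚ.< ε)
  (sym (trans (cong (ℚ._- seq y n) (eq n)) (ℚ.+-inverseʳ (seq y n)))) 0<ε

≃-refl : ∀ {x} → x ≃ x
≃-refl = pointwise λ _ → refl

≃-sym : ∀ {x y} → x ≃ y → y ≃ x
≃-sym {x} {y} (mk≃ x≈y) = mk≃ λ ε 0<ε → eventually-map
  (λ n → subst (ℚ._< ε) (∣p-q∣≡∣q-p∣ (seq x n) (seq y n))) (x≈y ε 0<ε)

≃-trans : ∀ {x y z} → x ≃ y → y ≃ z → x ≃ z
≃-trans {x} {y} {z} (mk≃ x≈y) (mk≃ y≈z) = mk≃ λ ε 0<ε → eventually-zip
  (λ n p q → ℚ.≤-<-trans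
    (ℚ.≤-trans
      (ℚ.≤-reflexive (cong ℚ.∣_∣
        (solve 3 (λ p q r → p :- r := (p :- q) :+ (q :- r)) refl (seq x n) (seq y n) (seq z n))))
      (ℚ.∣p+q∣≤∣p∣+∣q∣ (seq x n ℚ.- seq y n) (seq y n ℚ.- seq z n)))
    (subst (_ ℚ.<_) (half+half ε) (ℚ.+-mono-< p q)))
  (x≈y (half ε) (0<half 0<ε)) (y≈z (half ε) (0<half 0<ε))

≃-setoid : Setoid 0ℓ 0ℓ
≃-setoid = record
  { Carrier = ℝ ; _≈_ = _≃_
  ; isEquivalence = record { refl = ≃-refl ; sym = ≃-sym ; trans = ≃-trans } }

module ≃-Reasoning = SetoidReasoning ≃-setoid

+-cong : ∀ {x y u v} → x ≃ y → u ≃ v → x + u ≃ y + v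
+-cong {x} {y} {u} {v} (mk≃ x≈y) (mk≃ u≈v) = mk≃ λ ε 0<ε → eventually-zip
  (λ n p q → ℚ.≤-<-trans
    (ℚ.≤-trans
      (ℚ.≤-reflexive (cong ℚ.∣_∣
        (solve 4 (λ x y u v → (x :+ u) :- (y :+ v) := (x :- y) :+ (u :- v)) refl
          (seq x n) (seq y n) (seq u n) (seq v n))))
      (ℚ.∣p+q∣≤∣p∣+∣q∣ (seq x n ℚ.- seq y n) (seq u n ℚ.- seq v n)))
    (subst (_ ℚ.<_) (half+half ε) (ℚ.+-mono-< p q)))
  (x≈y (half ε) (0<half 0<ε)) (u≈v (half ε) (0<half 0<ε))

quotient : ∀ {p q} → 0ℚ ℚ.< p → 0ℚ ℚ.< q → Σ[ r ∈ ℚ ] 0ℚ ℚ.< r × r ℚ.* q ≡ p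
quotient {p} {q} 0<p 0<q =
  p ℚ.* ℚ.1/ q , 0<p*q 0<p (ℚ.positive⁻¹ (ℚ.1/ q) {{ℚ.1/pos⇒pos q}}) ,
  trans (ℚ.*-assoc p (ℚ.1/ q) q)
    (trans (cong (p ℚ.*_) (ℚ.*-inverseˡ q)) (ℚ.*-identityʳ p))
  where
  instance
    q-pos : ℚ.Positive q
    q-pos = ℚ.positive 0<q
    q-nonZero : ℚ.NonZero q
    q-nonZero = ℚ.pos⇒nonZero q

-- The tail of z is bounded by some B, so the tolerance η = ε / B for x - y suffices.
*-congʳ : ∀ {x y} z → x ≃ y → x * z ≃ y * z
*-congʳ {x} {y} z (mk≃ x≈y) = mk≃ λ ε 0<ε →
  let B , 0<B , ∣z∣<B = bounded z
      η , 0<η , η*B≡ε = quotient 0<ε 0<B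
      instance
        η-pos : ℚ.Positive η
        η-pos = ℚ.positive 0<η
  in eventually-zip
    (λ n p q → ℚ.≤-<-trans
      (ℚ.≤-trans
        (ℚ.≤-reflexive (trans
          (cong ℚ.∣_∣ (solve 3 (λ x y z → x :* z :- y :* z := (x :- y) :* z) refl
            (seq x n) (seq y n) (seq z n)))
          (ℚ.∣p*q∣≡∣p∣*∣q∣ (seq x n ℚ.- seq y n) (seq z n))))
        (ℚ.*-monoʳ-≤-nonNeg ℚ.∣ seq z n ∣ {{ℚ.∣-∣-nonNeg (seq z n)}} (ℚ.<⇒≤ p)))
      (subst (λ e → η ℚ.* ℚ.∣ seq z n ∣ ℚ.< e) η*B≡ε (ℚ.*-monoʳ-<-pos η q)))
    (x≈y η 0<η) ∣z∣<B

*-comm : ∀ x y → x * y ≃ y * x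
*-comm x y = pointwise λ n → ℚ.*-comm (seq x n) (seq y n)

*-congˡ : ∀ {x y} z → x ≃ y → z * x ≃ z * y
*-congˡ {x} {y} z x≃y =
  ≃-trans (*-comm z x) (≃-trans (*-congʳ z x≃y) (*-comm y z))

*-cong : ∀ {x y u v} → x ≃ y → u ≃ v → x * u ≃ y * v
*-cong {y = y} {u = u} x≃y u≃v = ≃-trans (*-congʳ u x≃y) (*-congˡ y u≃v)

-‿cong : ∀ {x y} → x ≃ y → - x ≃ - y
-‿cong = *-congˡ (fromℚ -1ℚ)

sum-cong : ∀ {n} {v w : Vector ℝ n} → (∀ i → v i ≃ w i) → sum v ≃ sum w
sum-cong {zero}  v≃w = ≃-refl
sum-cong {suc n} v≃w = +-cong (v≃w zero) (sum-cong (v≃w ∘ suc))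

zeroˡ : ∀ x → 0ℝ * x ≃ 0ℝ
zeroˡ x = pointwise λ n → ℚ.*-zeroˡ (seq x n)

zeroʳ : ∀ x → x * 0ℝ ≃ 0ℝ
zeroʳ x = pointwise λ n → ℚ.*-zeroʳ (seq x n)

sum-zero : ∀ {n} {v : Vector ℝ n} → (∀ i → v i ≃ 0ℝ) → sum v ≃ 0ℝ
sum-zero {zero}  v≃0 = ≃-refl
sum-zero {suc n} v≃0 = ≃-trans (+-cong (v≃0 zero) (sum-zero (v≃0 ∘ suc)))
  (pointwise λ _ → refl)

neg-zero : ∀ {x} → x ≃ 0ℝ → - x ≃ 0ℝ
neg-zero x≃0 = ≃-trans (-‿cong x≃0) (zeroʳ (fromℚ -1ℚ))

neg-neg : ∀ x → - (- x) ≃ x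
neg-neg x = pointwise λ n →
  solve 1 (λ x → con -1ℚ :* (con -1ℚ :* x) := x) refl (seq x n)

≃-shift : ∀ {x y} → x - y ≃ 0ℝ → x ≃ y
≃-shift {x} {y} x-y≃0 = begin
  x            ≈⟨ pointwise (λ n → solve 2 (λ x y → x := x :+ con -1ℚ :* y :+ y) refl
                    (seq x n) (seq y n)) ⟩
  (x - y) + y  ≈⟨ +-cong x-y≃0 ≃-refl ⟩
  0ℝ + y       ≈⟨ pointwise (λ n → ℚ.+-identityˡ (seq y n)) ⟩
  y            ∎
  where open ≃-Reasoning

≃-unshift : ∀ {x y} → x ≃ y → x - y ≃ 0ℝ
≃-unshift {x} {y} x≃y = ≃-trans (+-cong x≃y ≃-refl)
  (pointwise λ n → solve 1 (λ y → y :+ con -1ℚ :* y := con 0ℚ) refl (seq y n))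

-- Signs of reals

pos-gap : ∀ {x} → Pos x → Σ[ ε ∈ ℚ ] 0ℚ ℚ.< ε × Eventually (λ n → 0ℚ ℚ.< seq x n ℚ.- ε)
pos-gap {x} (pos (ε , 0<ε , ev)) = ε , 0<ε , eventually-map
  (λ n h → p<q⇒0<q-p (subst (ℚ._< seq x n) (ℚ.+-identityˡ ε) h)) ev

pos-intro : ∀ {x} ε → 0ℚ ℚ.< ε → Eventually (λ n → 0ℚ ℚ.< seq x n ℚ.- ε) → Pos x
pos-intro {x} ε 0<ε ev = pos (ε , 0<ε , eventually-map
  (λ n h → subst (ℚ._< seq x n) (sym (ℚ.+-identityˡ ε)) (0<q-p⇒p<q h)) ev)

-- Half of the gap below x absorbs the eventual difference of x and y; the other half remains as a
-- gap below y.
pos-resp : ∀ {x y} → x ≃ y → Pos x → Pos y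
pos-resp {x} {y} (mk≃ x≈y) Px with pos-gap Px
... | ε , 0<ε , ev = pos-intro (half ε) (0<half 0<ε) (eventually-zip
  (λ n p q → subst (0ℚ ℚ.<_)
    (solve 3 (λ x y ε → (x :- ε) :+ (con ½ :* ε :- (x :- y)) := y :- con ½ :* ε) refl
      (seq x n) (seq y n) ε)
    (0<p+q p (∣p∣<ε⇒0<ε-p q)))
  ev (x≈y (half ε) (0<half 0<ε)))

nonNeg-resp : ∀ {x y} → x ≃ y → NonNeg x → NonNeg y
nonNeg-resp {x} {y} (mk≃ x≈y) (nonNeg 0≤x) = nonNeg λ ε 0<ε → eventually-zip
  (λ n p q → subst (0ℚ ℚ.<_)
    (solve 3 (λ x y ε → (x :+ con ½ :* ε) :+ (con ½ :* ε :- (x :- y)) := y :+ ε) refl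
      (seq x n) (seq y n) ε)
    (0<p+q p (∣p∣<ε⇒0<ε-p q)))
  (0≤x (half ε) (0<half 0<ε)) (x≈y (half ε) (0<half 0<ε))

pos⇒nonNeg : ∀ {x} → Pos x → NonNeg x
pos⇒nonNeg {x} Px with pos-gap Px
... | δ , 0<δ , ev = nonNeg λ ε 0<ε → eventually-map
  (λ n p → subst (0ℚ ℚ.<_)
    (solve 3 (λ x δ ε → (x :- δ) :+ (δ :+ ε) := x :+ ε) refl (seq x n) δ ε)
    (0<p+q p (0<p+q 0<δ 0<ε))) ev

pos⇒≄0 : ∀ {x} → Pos x → ¬ (x ≃ 0ℝ)
pos⇒≄0 Px x≃0 =
  let ε , 0<ε , N , ev = pos-gap (pos-resp x≃0 Px) in ℚ.<-irrefl refl
    (subst (0ℚ ℚ.<_) (solve 1 (λ ε → (con 0ℚ :- ε) :+ ε := con 0ℚ) refl ε)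
      (0<p+q (ev N ℕ.≤-refl) 0<ε))

nonNeg-0 : ∀ {x} → x ≃ 0ℝ → NonNeg x
nonNeg-0 x≃0 = nonNeg-resp (≃-sym x≃0) (nonNeg λ ε 0<ε →
  0 , λ _ _ → subst (0ℚ ℚ.<_) (sym (ℚ.+-identityˡ ε)) 0<ε)

nonNeg-+ : ∀ {x y} → NonNeg x → NonNeg y → NonNeg (x + y)
nonNeg-+ {x} {y} (nonNeg 0≤x) (nonNeg 0≤y) = nonNeg λ ε 0<ε → eventually-zip
  (λ n p q → subst (0ℚ ℚ.<_)
    (solve 3 (λ x y ε → (x :+ con ½ :* ε) :+ (y :+ con ½ :* ε) := (x :+ y) :+ ε) refl
      (seq x n) (seq y n) ε)
    (0<p+q p q))
  (0≤x (half ε) (0<half 0<ε)) (0≤y (half ε) (0<half 0<ε))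

-- Eventually x > -η and 0 < y < B, where η * B = ε, so x y + ε = (x + η) y + η (B - y) is a sum of
-- positive terms.
nonNeg-*-pos : ∀ {x y} → NonNeg x → Pos y → NonNeg (x * y)
nonNeg-*-pos {x} {y} (nonNeg 0≤x) Py = nonNeg λ ε 0<ε →
  let δ , 0<δ , y>δ = pos-gap Py
      B , 0<B , ∣y∣<B = bounded y
      η , 0<η , η*B≡ε = quotient 0<ε 0<B
  in eventually-zip
    (λ n p (q , r) → subst (0ℚ ℚ.<_)
      (trans
        (solve 5 (λ x y η B δ → (x :+ η) :* ((y :- δ) :+ δ) :+ η :* (B :- y) := x :* y :+ η :* B)
          refl (seq x n) (seq y n) η B δ)
        (cong (seq x n ℚ.* seq y n ℚ.+_) η*B≡ε))
      (0<p+q (0<p*q p (0<p+q q 0<δ)) (0<p*q 0<η (∣p∣<ε⇒0<ε-p r))))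
    (0≤x η 0<η) (eventually-zip (λ _ → _,_) y>δ ∣y∣<B)

nonNeg-antisym : ∀ {x} → NonNeg x → NonNeg (- x) → x ≃ 0ℝ
nonNeg-antisym {x} (nonNeg 0≤x) (nonNeg 0≤-x) = mk≃ λ ε 0<ε → eventually-zip
  (λ n p q → 0<ε±p⇒∣p∣<ε
    (subst (0ℚ ℚ.<_) (solve 2 (λ x ε → con -1ℚ :* x :+ ε := ε :- (x :- con 0ℚ)) refl (seq x n) ε) q)
    (subst (0ℚ ℚ.<_) (solve 2 (λ x ε → x :+ ε := ε :+ (x :- con 0ℚ)) refl (seq x n) ε) p))
  (0≤x ε 0<ε) (0≤-x ε 0<ε)

-- One rational comparison decides, with η = ε / 4 and N a Cauchy index for η. If x at N exceeds
-- -2η, the tail exceeds -3η, hence -ε. Otherwise the tail lies below -η, which makes - x positive.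
¬pos⇒nonNeg : ∀ {x} → ¬ Pos (- x) → NonNeg x
¬pos⇒nonNeg {x} ¬P = nonNeg λ ε 0<ε → go ε (half (half ε)) (0<half (0<half 0<ε)) refl
  where
  go : ∀ ε η → 0ℚ ℚ.< η → η ≡ half (half ε) → Eventually (λ n → 0ℚ ℚ.< seq x n ℚ.+ ε)
  go ε η 0<η refl with cauchy x η 0<η
  ... | N , close with 0ℚ ℚ.<? seq x N ℚ.+ (η ℚ.+ η)
  ... | yes p = N , λ n N≤n → subst (0ℚ ℚ.<_)
    (solve 3 (λ a b ε → (b :+ (con ½ :* (con ½ :* ε) :+ con ½ :* (con ½ :* ε)))
        :+ (con ½ :* (con ½ :* ε) :+ (a :- b)) :+ con ½ :* (con ½ :* ε) := a :+ ε)
      refl (seq x n) (seq x N) ε)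
    (0<p+q (0<p+q p (∣p∣<ε⇒0<ε+p (close n N N≤n ℕ.≤-refl))) 0<η)
  ... | no ¬p = contradiction (pos-intro η 0<η (N , λ n N≤n → subst (0ℚ ℚ.<_)
    (solve 3 (λ a b η → (η :- (a :- b)) :+ :- (b :+ (η :+ η)) := con -1ℚ :* a :- η)
      refl (seq x n) (seq x N) η)
    (ℚ.<-≤-trans (∣p∣<ε⇒0<ε-p (close n N N≤n ℕ.≤-refl))
      (subst (ℚ._≤ (η ℚ.- (seq x n ℚ.- seq x N)) ℚ.+ ℚ.- (seq x N ℚ.+ (η ℚ.+ η))) (ℚ.+-identityʳ _)
        (ℚ.+-monoʳ-≤ (η ℚ.- (seq x n ℚ.- seq x N)) (ℚ.neg-antimono-≤ (ℚ.≮⇒≥ ¬p))))))) ¬P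

trichotomy : ∀ {x} → ¬ Pos x → ¬ Pos (- x) → x ≃ 0ℝ
trichotomy {x} ¬P ¬N =
  nonNeg-antisym (¬pos⇒nonNeg ¬N) (¬pos⇒nonNeg (¬P ∘ pos-resp (neg-neg x)))

-- If y exceeds δ eventually, then |x| δ is at most |x y|, which is below ε δ; the rational δ
-- cancels.
pos-cancel : ∀ {x y} → Pos y → x * y ≃ 0ℝ → x ≃ 0ℝ
pos-cancel {x} {y} Py (mk≃ xy≈0) with pos-gap Py
... | δ , 0<δ , ev = mk≃ λ ε 0<ε → eventually-zip
  (λ n p q → ℚ.*-cancelʳ-<-nonNeg δ {{ℚ.nonNegative (ℚ.<⇒≤ 0<δ)}}
    (ℚ.≤-<-trans
      (ℚ.≤-trans
        (ℚ.*-monoˡ-≤-nonNeg ℚ.∣ seq x n ℚ.- 0ℚ ∣ {{ℚ.∣-∣-nonNeg (seq x n ℚ.- 0ℚ)}}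
          (ℚ.≤-trans (ℚ.<⇒≤ (0<q-p⇒p<q p)) (p≤∣p∣ (seq y n))))
        (ℚ.≤-reflexive (trans (sym (ℚ.∣p*q∣≡∣p∣*∣q∣ (seq x n ℚ.- 0ℚ) (seq y n)))
          (cong ℚ.∣_∣ (solve 2 (λ x y → (x :- con 0ℚ) :* y := x :* y :- con 0ℚ) refl
            (seq x n) (seq y n))))))
      q))
  ev (xy≈0 (ε ℚ.* δ) (0<p*q 0<ε 0<δ))

nonNeg-sum-zeroˡ : ∀ {x y} → NonNeg x → NonNeg y → x + y ≃ 0ℝ → x ≃ 0ℝ
nonNeg-sum-zeroˡ {x} {y} 0≤x 0≤y x+y≃0 = nonNeg-antisym 0≤x (nonNeg-resp eq 0≤y)
  where
  open ≃-Reasoning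
  eq : y ≃ - x
  eq = begin
    y              ≈⟨ pointwise (λ n → solve 2 (λ x y → y := x :+ y :+ con -1ℚ :* x) refl
                        (seq x n) (seq y n)) ⟩
    (x + y) + - x  ≈⟨ +-cong x+y≃0 ≃-refl ⟩
    0ℝ + - x       ≈⟨ pointwise (λ n → ℚ.+-identityˡ (seq (- x) n)) ⟩
    - x            ∎

+-comm : ∀ x y → x + y ≃ y + x
+-comm x y = pointwise λ n → ℚ.+-comm (seq x n) (seq y n)

nonNeg-sum-zeroʳ : ∀ {x y} → NonNeg x → NonNeg y → x + y ≃ 0ℝ → y ≃ 0ℝ
nonNeg-sum-zeroʳ {x} {y} 0≤x 0≤y x+y≃0 =
  nonNeg-sum-zeroˡ 0≤y 0≤x (≃-trans (+-comm y x) x+y≃0)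

nonNeg-sum : ∀ {n} {v : Vector ℝ n} → (∀ i → NonNeg (v i)) → NonNeg (sum v)
nonNeg-sum {zero}  0≤v = nonNeg-0 ≃-refl
nonNeg-sum {suc n} 0≤v = nonNeg-+ (0≤v zero) (nonNeg-sum (0≤v ∘ suc))

sum-zero⁻¹ : ∀ {n} {v : Vector ℝ n} → (∀ i → NonNeg (v i)) → sum v ≃ 0ℝ → ∀ i → v i ≃ 0ℝ
sum-zero⁻¹ 0≤v Σv≃0 zero    = nonNeg-sum-zeroˡ (0≤v zero) (nonNeg-sum (0≤v ∘ suc)) Σv≃0
sum-zero⁻¹ 0≤v Σv≃0 (suc i) = sum-zero⁻¹ (0≤v ∘ suc)
  (nonNeg-sum-zeroʳ (0≤v zero) (nonNeg-sum (0≤v ∘ suc)) Σv≃0) i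

fromℚ-injective : ∀ {q} → fromℚ q ≃ 0ℝ → q ≡ 0ℚ
fromℚ-injective {q} (mk≃ q≈0) with q ℚ.≟ 0ℚ
... | yes q≡0 = q≡0
... | no  q≢0 with q≈0 ℚ.∣ q ∣ (ℚ.≰⇒> λ ∣q∣≤0 → q≢0 (ℚ.∣p∣≡0⇒p≡0 q (ℚ.≤-antisym ∣q∣≤0 (ℚ.0≤∣p∣ q))))
... | N , close = contradiction
  (subst (λ p → ℚ.∣ p ∣ ℚ.< ℚ.∣ q ∣) (ℚ.+-identityʳ q) (close N ℕ.≤-refl)) (ℚ.<-irrefl refl)

fromℚ-cancel : ∀ {q x} → q ≢ 0ℚ → fromℚ q * x ≃ 0ℝ → x ≃ 0ℝ
fromℚ-cancel {q} {x} q≢0 qx≃0 = begin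
  x                               ≈⟨ pointwise invert ⟩
  fromℚ (ℚ.1/ q) * (fromℚ q * x)  ≈⟨ *-congˡ (fromℚ (ℚ.1/ q)) qx≃0 ⟩
  fromℚ (ℚ.1/ q) * 0ℝ             ≈⟨ zeroʳ (fromℚ (ℚ.1/ q)) ⟩
  0ℝ                              ∎
  where
  open ≃-Reasoning
  instance
    q-nonZero : ℚ.NonZero q
    q-nonZero = ℚ.≢-nonZero q≢0
  invert : ∀ n → seq x n ≡ ℚ.1/ q ℚ.* (q ℚ.* seq x n)
  invert n = sym (trans (sym (ℚ.*-assoc (ℚ.1/ q) q (seq x n)))
    (trans (cong (ℚ._* seq x n) (ℚ.*-inverseˡ q)) (ℚ.*-identityˡ (seq x n))))

-- Orientation of points in space

-- Over an arbitrary carrier, so that the same expressions serve for reals and for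
-- the polynomials of the ring solver.
module Determinants {A : Set} (_⊕_ _⊗_ : A → A → A) (-1# 0# : A) where

  infixl 6 _⊖_
  _⊖_ : Vector A 3 → Vector A 3 → Vector A 3
  (x ⊖ y) k = x k ⊕ (-1# ⊗ y k)

  -- The trailing `0#` makes this unfold, over the reals, to the same expression as `dot`.
  inner : Vector A 3 → Vector A 3 → A
  inner u x = (u 0F ⊗ x 0F) ⊕ ((u 1F ⊗ x 1F) ⊕ ((u 2F ⊗ x 2F) ⊕ 0#))

  minor : A → A → A → A → A
  minor a b c d = (a ⊗ d) ⊕ (-1# ⊗ (b ⊗ c))

  cross : Vector A 3 → Vector A 3 → Vector A 3
  cross x y 0F = minor (x 1F) (x 2F) (y 1F) (y 2F)
  cross x y 1F = minor (x 2F) (x 0F) (y 2F) (y 0F)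
  cross x y 2F = minor (x 0F) (x 1F) (y 0F) (y 1F)

  normal : Vector A 3 → Vector A 3 → Vector A 3 → Vector A 3
  normal p q r = cross (q ⊖ p) (r ⊖ p)

  affine : Vector A 3 → A → Vector A 3 → A
  affine u h x = inner u x ⊕ h

  -- The determinant of q - p, r - p, s - p, arranged as an affine function of s that vanishes on
  -- the plane through p, q, r.
  orient′ : Vector A 3 → Vector A 3 → Vector A 3 → Vector A 3 → A
  orient′ p q r = affine (normal p q r) (-1# ⊗ inner (normal p q r) p)

open Determinants _+_ _*_ (fromℚ -1ℚ) 0ℝ

private
  module P {n} = Determinants {Polynomial n} _:+_ _:*_ (con -1ℚ) (con 0ℚ)

  -- `remQuot` inverts `combine`, so the variable that `coordinate` assigns to coordinate c of point
  -- j receives exactly that value.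
  env : ∀ {k} → Vector ℝ³ k → ℕ → Vec ℚ (k ℕ.* 3)
  env {k} ps n = tabulate λ i → let j , c = remQuot {k} 3 i in seq (ps j c) n

  coordinate : ∀ {k} → Fin k → Vector (Polynomial (k ℕ.* 3)) 3
  coordinate j c = var (combine j c)

-- Real identities are checked by the rational ring solver at every index of the
-- underlying sequences.
identity : ∀ {k} (ps : Vector ℝ³ k)
  (eq : (Fin k → Vector (Polynomial (k ℕ.* 3)) 3) → Polynomial (k ℕ.* 3) × Polynomial (k ℕ.* 3)) →
  let l , r = eq coordinate in
  (∀ n → ⟦ l ⟧↓ (env ps n) ≡ ⟦ r ⟧↓ (env ps n)) →
  ∀ n → ⟦ l ⟧ (env ps n) ≡ ⟦ r ⟧ (env ps n)
identity ps eq normal≡ n = let l , r = eq coordinate in prove (env ps n) l r (normal≡ n)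

-- Opaque, since unfolding the Cauchy proofs in orient makes conversion checking
-- exponential.
opaque

  orient : ℝ³ → ℝ³ → ℝ³ → ℝ³ → ℝ
  orient = orient′

  orient-affine : ∀ p q r s → orient p q r s ≃ affine (normal p q r) (- inner (normal p q r) p) s
  orient-affine p q r s = ≃-refl

  orient-p : ∀ p q r → orient p q r p ≃ 0ℝ
  orient-p p q r = pointwise (identity (p ∷ᵛ q ∷ᵛ r ∷ᵛ []ᵛ)
    (λ x → P.orient′ (x 0F) (x 1F) (x 2F) (x 0F) := con 0ℚ) λ _ → refl)

  orient-q : ∀ p q r → orient p q r q ≃ 0ℝ
  orient-q p q r = pointwise (identity (p ∷ᵛ q ∷ᵛ r ∷ᵛ []ᵛ)
    (λ x → P.orient′ (x 0F) (x 1F) (x 2F) (x 1F) := con 0ℚ) λ _ → refl)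

  orient-r : ∀ p q r → orient p q r r ≃ 0ℝ
  orient-r p q r = pointwise (identity (p ∷ᵛ q ∷ᵛ r ∷ᵛ []ᵛ)
    (λ x → P.orient′ (x 0F) (x 1F) (x 2F) (x 2F) := con 0ℚ) λ _ → refl)

  -- Adjacent transpositions generate all permutations, so these three sign changes relate any two
  -- orders of the same four points.
  orient-swap₁₂ : ∀ p q r s → orient q p r s ≃ - orient p q r s
  orient-swap₁₂ p q r s = pointwise (identity (p ∷ᵛ q ∷ᵛ r ∷ᵛ s ∷ᵛ []ᵛ)
    (λ x → P.orient′ (x 1F) (x 0F) (x 2F) (x 3F)
      := con -1ℚ :* P.orient′ (x 0F) (x 1F) (x 2F) (x 3F)) λ _ → refl)

  orient-swap₂₃ : ∀ p q r s → orient p r q s ≃ - orient p q r s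
  orient-swap₂₃ p q r s = pointwise (identity (p ∷ᵛ q ∷ᵛ r ∷ᵛ s ∷ᵛ []ᵛ)
    (λ x → P.orient′ (x 0F) (x 2F) (x 1F) (x 3F)
      := con -1ℚ :* P.orient′ (x 0F) (x 1F) (x 2F) (x 3F)) λ _ → refl)

  orient-swap₃₄ : ∀ p q r s → orient p q s r ≃ - orient p q r s
  orient-swap₃₄ p q r s = pointwise (identity (p ∷ᵛ q ∷ᵛ r ∷ᵛ s ∷ᵛ []ᵛ)
    (λ x → P.orient′ (x 0F) (x 1F) (x 3F) (x 2F)
      := con -1ℚ :* P.orient′ (x 0F) (x 1F) (x 2F) (x 3F)) λ _ → refl)

  -- Cofactor expansion of the determinant along the first coordinate, which later serves as the
  -- height.
  orient-expand : ∀ v a b c → orient v a b c ≃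
    (v 0F - a 0F) * cross (c ⊖ v) (b ⊖ v) 0F + ((v 0F - b 0F) * cross (a ⊖ v) (c ⊖ v) 0F
      + (v 0F - c 0F) * cross (b ⊖ v) (a ⊖ v) 0F)
  orient-expand v a b c = pointwise (identity (v ∷ᵛ a ∷ᵛ b ∷ᵛ c ∷ᵛ []ᵛ)
    (λ x → let v = x 0F ; a = x 1F ; b = x 2F ; c = x 3F
               _∙_ = λ p q → p 0F :+ con -1ℚ :* q 0F in
      P.orient′ v a b c := (v ∙ a) :* P.cross (c P.⊖ v) (b P.⊖ v) 0F
        :+ ((v ∙ b) :* P.cross (a P.⊖ v) (c P.⊖ v) 0F
          :+ (v ∙ c) :* P.cross (b P.⊖ v) (a P.⊖ v) 0F)) λ _ → refl)

  -- The first coordinates of the affine dependency between five points.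
  orient-dependency : ∀ v a b c d →
    (v 0F - d 0F) * orient v a b c + ((v 0F - c 0F) * orient v b a d
      + ((v 0F - b 0F) * orient v c d a + (v 0F - a 0F) * orient v d c b)) ≃ 0ℝ
  orient-dependency v a b c d = pointwise (identity (v ∷ᵛ a ∷ᵛ b ∷ᵛ c ∷ᵛ d ∷ᵛ []ᵛ)
    (λ x → let v = x 0F ; a = x 1F ; b = x 2F ; c = x 3F ; d = x 4F
               _∙_ = λ p q → p 0F :+ con -1ℚ :* q 0F in
      (v ∙ d) :* P.orient′ v a b c :+ ((v ∙ c) :* P.orient′ v b a d
        :+ ((v ∙ b) :* P.orient′ v c d a :+ (v ∙ a) :* P.orient′ v d c b)) := con 0ℚ) λ _ → refl)

inner-cong : ∀ u {x y} → (∀ k → x k ≃ y k) → inner u x ≃ inner u y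
inner-cong u x≃y = +-cong (*-congˡ (u 0F) (x≃y 0F)) (+-cong (*-congˡ (u 1F) (x≃y 1F))
  (+-cong (*-congˡ (u 2F) (x≃y 2F)) ≃-refl))

affine-sum : ∀ {n} (w : Vector ℝ n) (p : Vector ℝ³ n) u h →
  sum (λ i → w i * affine u h (p i)) ≃
  inner u (λ k → sum (λ i → w i * p i k)) + h * sum w
affine-sum w p u h = pointwise λ m → go m w p
  where
  go : ∀ m {n} (w : Vector ℝ n) (p : Vector ℝ³ n) →
    seq (sum (λ i → w i * affine u h (p i))) m ≡
    seq (inner u (λ k → sum (λ i → w i * p i k)) + h * sum w) m
  go m {zero} w p = solve 4
    (λ a b c h → con 0ℚ := a :* con 0ℚ :+ (b :* con 0ℚ :+ (c :* con 0ℚ :+ con 0ℚ)) :+ h :* con 0ℚ)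
    refl (seq (u 0F) m) (seq (u 1F) m) (seq (u 2F) m) (seq h m)
  go m {suc n} w p = trans (cong (seq (w 0F * affine u h (p 0F)) m ℚ.+_) (go m (w ∘ suc) (p ∘ suc)))
    (solve 12
      (λ a b c h w x y z X Y Z W →
        w :* ((a :* x :+ (b :* y :+ (c :* z :+ con 0ℚ))) :+ h)
          :+ ((a :* X :+ (b :* Y :+ (c :* Z :+ con 0ℚ))) :+ h :* W)
        := (a :* (w :* x :+ X) :+ (b :* (w :* y :+ Y) :+ (c :* (w :* z :+ Z) :+ con 0ℚ)))
          :+ h :* (w :+ W))
      refl (seq (u 0F) m) (seq (u 1F) m) (seq (u 2F) m) (seq h m)
      (seq (w 0F) m) (seq (p 0F 0F) m) (seq (p 0F 1F) m) (seq (p 0F 2F) m)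
      (tails 0F) (tails 1F) (tails 2F) (seq (sum (w ∘ suc)) m))
    where
    tails : Fin 3 → ℚ
    tails k = seq (sum (λ i → w (suc i) * p (suc i) k)) m

sum-*ʳ : ∀ {n} (w : Vector ℝ n) y → sum (λ i → w i * y) ≃ sum w * y
sum-*ʳ {zero}  w y = ≃-sym (zeroˡ y)
sum-*ʳ {suc n} w y = ≃-trans (+-cong ≃-refl (sum-*ʳ (w ∘ suc) y))
  (pointwise λ n → sym (ℚ.*-distribʳ-+ (seq y n) (seq (w zero) n) (seq (sum (w ∘ suc)) n)))

-- Separating triangles by affine functions

-- Arguments about hulls use a function only through this form, so `orient` can stay opaque.
record Affine (f : ℝ³ → ℝ) : Set where
  field
    slope    : ℝ³
    constant : ℝ
    form     : ∀ x → f x ≃ affine slope constant x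

orient-isAffine : ∀ p q r → Affine (orient p q r)
orient-isAffine p q r = record
  { slope = normal p q r ; constant = - inner (normal p q r) p ; form = orient-affine p q r }

record Hull {n} (p : Vector ℝ³ n) (S : Subset n) (x : ℝ³) : Set where
  field
    weight     : Vector ℝ n
    weight≥0   : ∀ i → NonNeg (weight i)
    off        : ∀ i → i ∉ S → weight i ≃ 0ℝ
    total      : sum weight ≃ 1ℝ
    barycentre : ∀ k → x k ≃ sum (λ i → weight i * p i k)

toHull : ∀ {n} (p : Vector ℝ³ n) S x → ConvexHull p S x → Hull p S x
toHull p S x (w , 0≤w , off , Σw≈1 , x≈Σ) = record
  { weight = w ; weight≥0 = λ i → nonNeg (0≤w i) ; off = λ i i∉S → mk≃ (off i i∉S)
  ; total = mk≃ Σw≈1 ; barycentre = λ k → mk≃ (x≈Σ k) }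

term-nonNeg : ∀ {w y} → NonNeg w → Pos y ⊎ y ≃ 0ℝ → NonNeg (w * y)
term-nonNeg 0≤w (inj₁ 0<y) = nonNeg-*-pos 0≤w 0<y
term-nonNeg {w} _ (inj₂ y≃0) = nonNeg-0 (≃-trans (*-congˡ w y≃0) (zeroʳ w))

term-zeroˡ : ∀ {w} y → w ≃ 0ℝ → w * y ≃ 0ℝ
term-zeroˡ y w≃0 = ≃-trans (*-congʳ y w≃0) (zeroˡ y)

module _ {n} {p : Vector ℝ³ n} {S : Subset n} {x} (hull : Hull p S x) where

  open Hull hull renaming (weight to w; weight≥0 to 0≤w)

  module _ {f : ℝ³ → ℝ} (f-affine : Affine f) where

    open Affine f-affine renaming (slope to u; constant to h)

    -- The weights have total 1, so the value of an affine function at a barycentre is the weighted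
    -- mean of its values at the vertices.
    hull-affine : sum (λ i → w i * f (p i)) ≃ f x
    hull-affine = begin
      sum (λ i → w i * f (p i))
        ≈⟨ sum-cong (λ i → *-congˡ (w i) (form (p i))) ⟩
      sum (λ i → w i * affine u h (p i))
        ≈⟨ affine-sum w p u h ⟩
      inner u (λ k → sum (λ i → w i * p i k)) + h * sum w
        ≈⟨ +-cong (inner-cong u (λ k → ≃-sym (barycentre k))) (*-congˡ h total) ⟩
      inner u x + h * 1ℝ
        ≈⟨ +-cong (≃-refl {inner u x}) (pointwise (λ n → ℚ.*-identityʳ (seq h n))) ⟩
      affine u h x
        ≈⟨ form x ⟨
      f x ∎
      where open ≃-Reasoning

    module _ (sign : ∀ i → i ∈ S → Pos (f (p i)) ⊎ f (p i) ≃ 0ℝ) where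

      terms-nonNeg : ∀ i → NonNeg (w i * f (p i))
      terms-nonNeg i with i ∈? S
      ... | yes i∈S = term-nonNeg (0≤w i) (sign i i∈S)
      ... | no  i∉S = nonNeg-0 (term-zeroˡ _ (off i i∉S))

      hull-nonNeg : NonNeg (f x)
      hull-nonNeg = nonNeg-resp hull-affine (nonNeg-sum terms-nonNeg)

      -- A vanishing sum of nonnegative terms vanishes termwise: if x lies on the supporting plane f
      -- = 0, a vertex strictly off that plane carries no weight.
      hull-zero⁻¹ : f x ≃ 0ℝ → ∀ {i} → Pos (f (p i)) → w i ≃ 0ℝ
      hull-zero⁻¹ fx≃0 0<fpᵢ = pos-cancel 0<fpᵢ
        (sum-zero⁻¹ terms-nonNeg (≃-trans hull-affine fx≃0) _)

    -- The mean of equal values is that value. The first alternative admits the vertices whose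
    -- weight `hull-zero⁻¹` has shown to vanish.
    hull-constant : ∀ {y} → (∀ i → i ∈ S → w i ≃ 0ℝ ⊎ f (p i) ≃ y) → f x ≃ y
    hull-constant {y} const = begin
      f x                        ≈⟨ hull-affine ⟨
      sum (λ i → w i * f (p i))  ≈⟨ sum-cong term ⟩
      sum (λ i → w i * y)        ≈⟨ sum-*ʳ w y ⟩
      sum w * y                  ≈⟨ *-congʳ y total ⟩
      1ℝ * y                     ≈⟨ pointwise (λ n → ℚ.*-identityˡ (seq y n)) ⟩
      y                          ∎
      where
      open ≃-Reasoning
      term₀ : ∀ i → w i ≃ 0ℝ → w i * f (p i) ≃ w i * y
      term₀ i w≃0 = ≃-trans (term-zeroˡ _ w≃0) (≃-sym (term-zeroˡ y w≃0))
      term : ∀ i → w i * f (p i) ≃ w i * y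
      term i with i ∈? S
      ... | no  i∉S = term₀ i (off i i∉S)
      ... | yes i∈S with const i i∈S
      ...   | inj₁ w≃0 = term₀ i w≃0
      ...   | inj₂ f≃y = *-congˡ (w i) f≃y

neg-difference : ∀ x y → - (x - y) ≃ y - x
neg-difference x y = pointwise λ n → solve 2
  (λ x y → con -1ℚ :* (x :+ con -1ℚ :* y) := y :+ con -1ℚ :* x) refl (seq x n) (seq y n)

telescope : ∀ x y z → (x - y) + (y - z) ≃ x - z
telescope x y z = pointwise λ n → solve 3
  (λ x y z → (x :+ con -1ℚ :* y) :+ (y :+ con -1ℚ :* z) := x :+ con -1ℚ :* z) refl
  (seq x n) (seq y n) (seq z n)

-- Four points of equal height are coplanar: each term of the expansion contains a height
-- difference.
orient-vertical : ∀ v a b c → v 0F - a 0F ≃ 0ℝ → v 0F - b 0F ≃ 0ℝ → v 0F - c 0F ≃ 0ℝ →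
  orient v a b c ≃ 0ℝ
orient-vertical v a b c va vb vc = ≃-trans (orient-expand v a b c)
  (≃-trans (+-cong (term-zeroˡ _ va) (+-cong (term-zeroˡ _ vb) (term-zeroˡ _ vc)))
    (pointwise λ _ → refl))

-- The plane through v, a, c weakly separates the triangles.  A common point lies
-- on it, hence on the line through a and c and equals v, although v is off that line.
separated : ∀ {n} (p : Vector ℝ³ n) {S T : Subset n} {v a b c d w} →
  (∀ i → i ∈ S → i ≡ a ⊎ i ≡ c ⊎ i ≡ w) →
  (∀ i → i ∈ T → i ≡ v ⊎ i ≡ b ⊎ i ≡ d) →
  Pos (orient (p v) (p a) (p b) (p c)) →
  Pos (orient (p v) (p c) (p a) (p d)) →
  Pos (orient (p a) (p c) (p v) (p w)) →
  ∀ {x} → Hull p S x → ¬ Hull p T x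
separated p {S} {T} {v} {a} {b} {c} {d} {w} S⊆ T⊆ abc cad acvw {x} xS xT =
  pos⇒≄0 acbv (≃-trans (≃-sym gx≃gv) gx≃0)
  where
  V = p v ; A = p a ; B = p b ; C = p c ; D = p d ; W = p w
  double : ∀ {r s t} → r ≃ - s → s ≃ - t → r ≃ t
  double {t = t} r≃-s s≃-t = ≃-trans r≃-s (≃-trans (-‿cong s≃-t) (neg-neg t))
  vacw : Pos (orient V A C W)
  vacw = pos-resp (double (orient-swap₂₃ A V C W) (orient-swap₁₂ V A C W)) acvw
  vcab : Pos (orient V C A B)
  vcab = pos-resp (≃-sym (double (orient-swap₂₃ V A C B) (orient-swap₃₄ V A B C))) abc
  acbv : Pos (orient A C B V)
  acbv = pos-resp (≃-sym (≃-trans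
    (double (orient-swap₃₄ A C V B) (orient-swap₂₃ A V C B))
    (double (orient-swap₁₂ V A C B) (orient-swap₃₄ V A B C)))) abc
  signS : ∀ i → i ∈ S → Pos (orient V A C (p i)) ⊎ orient V A C (p i) ≃ 0ℝ
  signS i i∈S with S⊆ i i∈S
  ... | inj₁ refl        = inj₂ (orient-q V A C)
  ... | inj₂ (inj₁ refl) = inj₂ (orient-r V A C)
  ... | inj₂ (inj₂ refl) = inj₁ vacw
  signT : ∀ i → i ∈ T → Pos (orient V C A (p i)) ⊎ orient V C A (p i) ≃ 0ℝ
  signT i i∈T with T⊆ i i∈T
  ... | inj₁ refl        = inj₂ (orient-p V C A)
  ... | inj₂ (inj₁ refl) = inj₁ vcab
  ... | inj₂ (inj₂ refl) = inj₁ cad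
  fx≃0 : orient V A C x ≃ 0ℝ
  fx≃0 = nonNeg-antisym (hull-nonNeg xS (orient-isAffine V A C) signS)
    (nonNeg-resp (orient-swap₂₃ V A C x) (hull-nonNeg xT (orient-isAffine V C A) signT))
  f′x≃0 : orient V C A x ≃ 0ℝ
  f′x≃0 = ≃-trans (orient-swap₂₃ V A C x) (neg-zero fx≃0)
  -- The function `orient A C B` detects the contradiction. It vanishes at a and c, the only
  -- vertices of S that can carry weight, and is positive at v, the only such vertex of T.
  gx≃0 : orient A C B x ≃ 0ℝ
  gx≃0 = hull-constant xS (orient-isAffine A C B) λ i i∈S → go i (S⊆ i i∈S)
    where
    go : ∀ i → i ≡ a ⊎ i ≡ c ⊎ i ≡ w → Hull.weight xS i ≃ 0ℝ ⊎ orient A C B (p i) ≃ 0ℝ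
    go i (inj₁ refl)        = inj₂ (orient-p A C B)
    go i (inj₂ (inj₁ refl)) = inj₂ (orient-q A C B)
    go i (inj₂ (inj₂ refl)) = inj₁ (hull-zero⁻¹ xS (orient-isAffine V A C) signS fx≃0 vacw)
  gx≃gv : orient A C B x ≃ orient A C B V
  gx≃gv = hull-constant xT (orient-isAffine A C B) λ i i∈T → go i (T⊆ i i∈T)
    where
    go : ∀ i → i ≡ v ⊎ i ≡ b ⊎ i ≡ d → Hull.weight xT i ≃ 0ℝ ⊎ orient A C B (p i) ≃ orient A C B V
    go i (inj₁ refl)        = inj₂ ≃-refl
    go i (inj₂ (inj₁ refl)) = inj₁ (hull-zero⁻¹ xT (orient-isAffine V C A) signT f′x≃0 vcab)
    go i (inj₂ (inj₂ refl)) = inj₁ (hull-zero⁻¹ xT (orient-isAffine V C A) signT f′x≃0 cad)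

cross-inner-p : ∀ p q e → inner (cross (q ⊖ p) e) (q ⊖ p) ≃ 0ℝ
cross-inner-p p q e = pointwise (identity (p ∷ᵛ q ∷ᵛ e ∷ᵛ []ᵛ)
  (λ x → P.inner (P.cross (x 1F P.⊖ x 0F) (x 2F)) (x 1F P.⊖ x 0F) := con 0ℚ) λ _ → refl)

-- Antisymmetry of the scalar triple product. It makes (q - p) × e orthogonal to r - p as soon as
-- the normal of p, q, r vanishes.
cross-inner-swap : ∀ p q r e → inner (cross (q ⊖ p) e) (r ⊖ p) ≃ - inner (normal p q r) e
cross-inner-swap p q r e = pointwise (identity (p ∷ᵛ q ∷ᵛ r ∷ᵛ e ∷ᵛ []ᵛ)
  (λ x → P.inner (P.cross (x 1F P.⊖ x 0F) (x 3F)) (x 2F P.⊖ x 0F)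
    := con -1ℚ :* P.inner (P.normal (x 0F) (x 1F) (x 2F)) (x 3F)) λ _ → refl)

inner-⊖ : ∀ u p x → inner u x - inner u p ≃ inner u (x ⊖ p)
inner-⊖ u p x = pointwise (identity (u ∷ᵛ p ∷ᵛ x ∷ᵛ []ᵛ)
  (λ x → P.inner (x 0F) (x 2F) :+ con -1ℚ :* P.inner (x 0F) (x 1F)
    := P.inner (x 0F) (x 2F P.⊖ x 1F)) λ _ → refl)

inner-zeroˡ : ∀ {u} x → (∀ k → u k ≃ 0ℝ) → inner u x ≃ 0ℝ
inner-zeroˡ x u≃0 = ≃-trans
  (+-cong (term-zeroˡ (x 0F) (u≃0 0F)) (+-cong (term-zeroˡ (x 1F) (u≃0 1F))
    (+-cong (term-zeroˡ (x 2F) (u≃0 2F)) ≃-refl)))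
  (pointwise λ _ → refl)

-- Each of the vectors is normal to a plane through the four points, so all of them
-- vanish, and then so does q - p.
coplanar-degenerate : ∀ {p q r s} → ¬ Coplanar (p ∷ q ∷ r ∷ s ∷ []) →
  ¬ (p ≋ q) → ¬ (orient p q r s ≃ 0ℝ)
coplanar-degenerate {p} {q} {r} {s} ¬coplanar p≢q pqrs≃0 =
  vanish (normal p q r) (difference p q r q (orient-q p q r)) (difference p q r r (orient-r p q r))
    (difference p q r s pqrs≃0) λ n≃0 →
  vanish (normal p q s) (difference p q s q (orient-q p q s))
    (difference p q s r (≃-trans (orient-swap₃₄ p q r s) (neg-zero pqrs≃0)))
    (difference p q s s (orient-r p q s)) λ n′≃0 →
  vanish-cross e₀ n≃0 n′≃0 λ c₀≃0 →
  vanish-cross e₁ n≃0 n′≃0 λ c₁≃0 →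
  p≢q λ k → un≃ (≃-sym (≃-shift (diff c₀≃0 c₁≃0 k)))
  where
  -- Two axis vectors recover a whole vector: (x, y, z) × e₀ = (0, z, -y) and (x, y, z) × e₁ = (-z,
  -- 0, x).
  e₀ e₁ : ℝ³
  e₀ = 1ℝ ∷ᵛ 0ℝ ∷ᵛ 0ℝ ∷ᵛ []ᵛ
  e₁ = 0ℝ ∷ᵛ 1ℝ ∷ᵛ 0ℝ ∷ᵛ []ᵛ

  difference : ∀ p q r x → orient p q r x ≃ 0ℝ →
    inner (normal p q r) x - inner (normal p q r) p ≃ 0ℝ
  difference p q r x = ≃-trans (≃-sym (orient-affine p q r x))

  vanish : ∀ u →
    inner u q - inner u p ≃ 0ℝ → inner u r - inner u p ≃ 0ℝ → inner u s - inner u p ≃ 0ℝ →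
    ¬ ¬ (∀ k → u k ≃ 0ℝ)
  vanish u uq ur us ¬u≃0 = ¬coplanar (u , inner u p , (λ u≋0 → ¬u≃0 λ k → mk≃ (u≋0 k)) ,
    un≃ (≃-refl {inner u p}) ∷ un≃ (≃-shift uq) ∷ un≃ (≃-shift ur) ∷ un≃ (≃-shift us) ∷ [])

  vanish-cross : ∀ e → (∀ k → normal p q r k ≃ 0ℝ) → (∀ k → normal p q s k ≃ 0ℝ) →
    ¬ ¬ (∀ k → cross (q ⊖ p) e k ≃ 0ℝ)
  vanish-cross e n≃0 n′≃0 = vanish (cross (q ⊖ p) e)
    (≃-trans (inner-⊖ u p q) (cross-inner-p p q e))
    (≃-trans (inner-⊖ u p r) (≃-trans (cross-inner-swap p q r e) (neg-zero (inner-zeroˡ e n≃0))))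
    (≃-trans (inner-⊖ u p s) (≃-trans (cross-inner-swap p q s e) (neg-zero (inner-zeroˡ e n′≃0))))
    where u = cross (q ⊖ p) e

  diff : (∀ k → cross (q ⊖ p) e₀ k ≃ 0ℝ) → (∀ k → cross (q ⊖ p) e₁ k ≃ 0ℝ) →
    ∀ k → q k - p k ≃ 0ℝ
  diff c₀ c₁ 0F = ≃-trans (pointwise λ n → solve 3
      (λ x y z → x := x :* con 1ℚ :+ con -1ℚ :* (y :* con 0ℚ)) refl
      (seq ((q ⊖ p) 0F) n) (seq ((q ⊖ p) 1F) n) (seq ((q ⊖ p) 2F) n)) (c₁ 2F)
  diff c₀ c₁ 1F = ≃-trans (pointwise λ n → solve 3
      (λ x y z → y := con -1ℚ :* (x :* con 0ℚ :+ con -1ℚ :* (y :* con 1ℚ))) refl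
      (seq ((q ⊖ p) 0F) n) (seq ((q ⊖ p) 1F) n) (seq ((q ⊖ p) 2F) n)) (neg-zero (c₀ 2F))
  diff c₀ c₁ 2F = ≃-trans (pointwise λ n → solve 3
      (λ x y z → z := z :* con 1ℚ :+ con -1ℚ :* (x :* con 0ℚ)) refl
      (seq ((q ⊖ p) 0F) n) (seq ((q ⊖ p) 1F) n) (seq ((q ⊖ p) 2F) n)) (c₀ 1F)

-- Marking the edges of a hypergraph

lookup-injective : ∀ {A : Set} {xs : List A} → Unique xs →
  ∀ i j → lookup xs i ≡ lookup xs j → i ≡ j
lookup-injective (_  ∷ _) zero    zero    _  = refl
lookup-injective (x∉ ∷ _) zero    (suc j) eq = contradiction eq (All.lookup x∉ (∈-lookup j))
lookup-injective (x∉ ∷ _) (suc i) zero    eq = contradiction (sym eq) (All.lookup x∉ (∈-lookup i))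
lookup-injective (_  ∷ u) (suc i) (suc j) eq = cong suc (lookup-injective u i j eq)

triple : ∀ {n} → Fin n → Fin n → Fin n → Subset n
triple i j k = ⁅ i ⁆ ∪ ⁅ j ⁆ ∪ ⁅ k ⁆

∈-triple⁻ : ∀ {n} {i j k : Fin n} x → x ∈ triple i j k → x ≡ i ⊎ x ≡ j ⊎ x ≡ k
∈-triple⁻ {i = i} {j} {k} x x∈ with x∈p∪q⁻ ⁅ i ⁆ (⁅ j ⁆ ∪ ⁅ k ⁆) x∈
... | inj₁ x∈i = inj₁ (x∈⁅y⁆⇒x≡y i x∈i)
... | inj₂ x∈jk with x∈p∪q⁻ ⁅ j ⁆ ⁅ k ⁆ x∈jk
...   | inj₁ x∈j = inj₂ (inj₁ (x∈⁅y⁆⇒x≡y j x∈j))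
...   | inj₂ x∈k = inj₂ (inj₂ (x∈⁅y⁆⇒x≡y k x∈k))

triple-rotate : ∀ {n} (i j k : Fin n) → triple i j k ≡ triple j k i
triple-rotate i j k =
  trans (∪-comm ⁅ i ⁆ (⁅ j ⁆ ∪ ⁅ k ⁆)) (∪-assoc ⁅ j ⁆ ⁅ k ⁆ ⁅ i ⁆)

triple-swap : ∀ {n} (i j k : Fin n) → triple i j k ≡ triple i k j
triple-swap i j k = cong (⁅ i ⁆ ∪_) (∪-comm ⁅ j ⁆ ⁅ k ⁆)

∣p∣≡0⇒p≡∅ : ∀ {n} (p : Subset n) → ∣ p ∣ ≡ 0 → p ≡ ∅
∣p∣≡0⇒p≡∅ []            refl = refl
∣p∣≡0⇒p≡∅ (outside ∷ p) eq   = cong (outside ∷_) (∣p∣≡0⇒p≡∅ p eq)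

∣p∣≡1⇒singleton : ∀ {n} (p : Subset n) → ∣ p ∣ ≡ 1 → ∃[ i ] p ≡ ⁅ i ⁆
∣p∣≡1⇒singleton (inside  ∷ p) eq = zero , cong (inside ∷_) (∣p∣≡0⇒p≡∅ p (ℕ.suc-injective eq))
∣p∣≡1⇒singleton (outside ∷ p) eq =
  let i , p≡i = ∣p∣≡1⇒singleton p eq in suc i , cong (outside ∷_) p≡i

∣p∣≡2⇒pair : ∀ {n} (p : Subset n) → ∣ p ∣ ≡ 2 →
  ∃[ i ] ∃[ j ] i ≢ j × p ≡ ⁅ i ⁆ ∪ ⁅ j ⁆
∣p∣≡2⇒pair (inside ∷ p) eq =
  let i , p≡i = ∣p∣≡1⇒singleton p (ℕ.suc-injective eq) in
  zero , suc i , (λ ()) , cong (inside ∷_) (trans p≡i (sym (∪-identityˡ ⁅ i ⁆)))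
∣p∣≡2⇒pair (outside ∷ p) eq =
  let i , j , i≢j , p≡ij = ∣p∣≡2⇒pair p eq in
  suc i , suc j , i≢j ∘ suc-injective , cong (outside ∷_) p≡ij

∣p∣≡3⇒triple : ∀ {n} (p : Subset n) → ∣ p ∣ ≡ 3 →
  ∃[ i ] ∃[ j ] ∃[ k ] i ≢ j × j ≢ k × i ≢ k × p ≡ triple i j k
∣p∣≡3⇒triple (inside ∷ p) eq =
  let i , j , i≢j , p≡ij = ∣p∣≡2⇒pair p (ℕ.suc-injective eq) in
  zero , suc i , suc j , (λ ()) , i≢j ∘ suc-injective , (λ ()) ,
  cong (inside ∷_) (trans p≡ij (sym (∪-identityˡ (⁅ i ⁆ ∪ ⁅ j ⁆))))
∣p∣≡3⇒triple (outside ∷ p) eq =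
  let i , j , k , i≢j , j≢k , i≢k , p≡ijk = ∣p∣≡3⇒triple p eq in
  suc i , suc j , suc k , i≢j ∘ suc-injective , j≢k ∘ suc-injective , i≢k ∘ suc-injective ,
  cong (outside ∷_) p≡ijk

module UpperBound {n} (H : GeometricHypergraph n) (¬disjoint : ¬ HasTwoDisjointEdges H)
  (pos? : ∀ i j k l → Dec (Pos (orient (point H i) (point H j) (point H k) (point H l))))
  (below? : ∀ i j → Dec (NonNeg (point H i 0F - point H j 0F)))
  where

  private
    p = point H

  χ : Fin n → Fin n → Fin n → Fin n → ℝ
  χ i j k l = orient (p i) (p j) (p k) (p l)

  -- If neither sign held, the orientation would vanish and the four points would be coplanar,
  -- against general position.
  χ-nonzero : ∀ {i j k l} → i ≢ j → i ≢ k → i ≢ l → j ≢ k → j ≢ l → k ≢ l →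
    Pos (χ i j k l) ⊎ Pos (χ i j l k)
  χ-nonzero {i} {j} {k} {l} i≢j i≢k i≢l j≢k j≢l k≢l with pos? i j k l | pos? i j l k
  ... | yes 0<χ | _       = inj₁ 0<χ
  ... | no _    | yes 0<χ = inj₂ 0<χ
  ... | no χ≯0  | no χ′≯0 = contradiction
    (trichotomy χ≯0 (χ′≯0 ∘ pos-resp (≃-sym (orient-swap₃₄ (p i) (p j) (p k) (p l)))))
    (coplanar-degenerate
      (GeneralPosition.no-four-on-plane (general-position H) i j k l
        ((i≢j ∷ i≢k ∷ i≢l ∷ []) ∷ (j≢k ∷ j≢l ∷ []) ∷ (k≢l ∷ []) ∷ [] ∷ []))
      (i≢j ∘ GeneralPosition.distinct (general-position H)))

  Edge : Fin n → Fin n → Fin n → Set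
  Edge i j k = i ≢ j × j ≢ k × i ≢ k × triple i j k ∈ˡ edges H

  edge? : ∀ i j k → Dec (Edge i j k)
  edge? i j k = ¬? (i ≟ᶠ j) ×-dec ¬? (j ≟ᶠ k) ×-dec ¬? (i ≟ᶠ k) ×-dec (triple i j k ∈ˡ? edges H)
    where open DecMembership (≡-dec Bool._≟_) using () renaming (_∈?_ to _∈ˡ?_)

  rotate : ∀ {i j k} → Edge i j k → Edge j k i
  rotate {i} {j} {k} (i≢j , j≢k , i≢k , e∈) = j≢k , ≢-sym i≢k , ≢-sym i≢j ,
    subst (_∈ˡ edges H) (triple-rotate i j k) e∈

  swap : ∀ {i j k} → Edge i j k → Edge i k j
  swap {i} {j} {k} (i≢j , j≢k , i≢k , e∈) = i≢k , ≢-sym j≢k , i≢j ,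
    subst (_∈ˡ edges H) (triple-swap i j k) e∈

  -- Some triangle ijy comes after ijx in the rotation about the directed line ij. The family Q is
  -- `Edge` in the first round of marking and `Inner` in the second.
  Follows : (Fin n → Fin n → Fin n → Set) → Fin n → Fin n → Fin n → Set
  Follows Q i j x = ∃[ y ] Q i j y × Pos (χ i j x y)

  follows? : ∀ {Q} → (∀ i j x → Dec (Q i j x)) → ∀ i j x → Dec (Follows Q i j x)
  follows? Q? i j x = any? λ y → Q? i j y ×-dec pos? i j x y

  Last : (Fin n → Fin n → Fin n → Set) → Fin n → Fin n → Fin n → Set
  Last Q i j x = Q i j x × ¬ Follows Q i j x

  -- Of two distinct triangles on the pair (i , j), one follows the other by `χ-nonzero`.
  last-unique : ∀ {Q} → (∀ {i j x} → Q i j x → Edge i j x) →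
    ∀ {i j x y} → Last Q i j x → Last Q i j y → x ≡ y
  last-unique Q⇒E {i} {j} {x} {y} (qx , ¬fx) (qy , ¬fy) with x ≟ᶠ y | Q⇒E qx | Q⇒E qy
  ... | yes x≡y | _ | _ = x≡y
  ... | no  x≢y | i≢j , j≢x , i≢x , _ | _ , j≢y , i≢y , _
    with χ-nonzero i≢j i≢x i≢y j≢x j≢y x≢y
  ...   | inj₁ 0<χ = contradiction (y , qy , 0<χ) ¬fx
  ...   | inj₂ 0<χ = contradiction (x , qx , 0<χ) ¬fy

  -- Height is the first coordinate, and ties are allowed.
  _≽_ : Fin n → Fin n → Set
  v ≽ a = NonNeg (p v 0F - p a 0F)

  ≽-total : ∀ u v → u ≽ v ⊎ v ≽ u
  ≽-total u v with below? u v
  ... | yes u≽v = inj₁ u≽v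
  ... | no  u⋡v = inj₂ (¬pos⇒nonNeg λ 0<-d →
    u⋡v (nonNeg-resp (neg-difference (p v 0F) (p u 0F)) (pos⇒nonNeg 0<-d)))

  ≽-trans : ∀ {u v w} → u ≽ v → v ≽ w → u ≽ w
  ≽-trans {u} {v} {w} u≽v v≽w =
    nonNeg-resp (telescope (p u 0F) (p v 0F) (p w 0F)) (nonNeg-+ u≽v v≽w)

  -- A triangle with highest vertex v that escapes the first mark at (a , x). The order of the
  -- arguments fixes (v , a) as its pair in the second round.
  record Inner (v a x : Fin n) : Set where
    constructor mkInner
    field
      edge    : Edge v a x
      follows : Follows Edge a x v
      top-a   : v ≽ a
      top-x   : v ≽ x

  open Inner

  inner? : ∀ v a x → Dec (Inner v a x)
  inner? v a x with edge? v a x ×-dec follows? edge? a x v ×-dec below? v a ×-dec below? v x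
  ... | yes (e , f , a≼v , x≼v) = yes (mkInner e f a≼v x≼v)
  ... | no ¬i = no λ (mkInner e f a≼v x≼v) → ¬i (e , f , a≼v , x≼v)

  -- The first hypothesis supplies an edge acw with w across the plane vac from b and d, so that acw
  -- and vbd would be disjoint edges.
  ¬separated : ∀ {v a b c d} → Follows Edge a c v → Edge v b d →
    Pos (χ v a b c) → ¬ Pos (χ v c a d)
  ¬separated {v} {a} {b} {c} {d} (w , (_ , _ , _ , acw∈) , acvw) (_ , _ , _ , vbd∈) vabc vcad =
    ¬disjoint (triple a c w , triple v b d , acw∈ , vbd∈ , λ x (x∈acw , x∈vbd) →
      separated p ∈-triple⁻ ∈-triple⁻ vabc vcad acvw
        (toHull p _ x x∈acw) (toHull p _ x x∈vbd))

  -- Let c and d be the two successors. Either d lies with b on one side of the plane vac, or c lies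
  -- with a on one side of vbd, or v is interior to the tetrahedron abcd. The first two cases give
  -- disjoint edges; the third contradicts the height of v.
  ¬all-follow : ∀ {v a b} → Inner v a b → Follows Inner v a b → ¬ Follows Inner v b a
  ¬all-follow {v} {a} {b} vab@(mkInner (v≢a , a≢b , v≢b , _) _ _ _)
    (c , vac@(mkInner (_ , a≢c , v≢c , _) _ _ _) , vabc)
    (d , vbd@(mkInner (_ , b≢d , v≢d , _) _ _ _) , vbad)
    with χ-nonzero v≢c v≢a v≢d (≢-sym a≢c) c≢d a≢d
       | χ-nonzero v≢d v≢b v≢c (≢-sym b≢d) (≢-sym c≢d) b≢c
    where
    a≢d : a ≢ d
    a≢d refl = pos⇒≄0 vbad (orient-r (p v) (p b) (p a))
    b≢c : b ≢ c
    b≢c refl = pos⇒≄0 vabc (orient-r (p v) (p a) (p b))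
    -- If c = d, the two successor conditions give opposite signs to the same orientation.
    c≢d : c ≢ d
    c≢d refl = pos⇒≄0 vabc (nonNeg-antisym (pos⇒nonNeg vabc)
      (nonNeg-resp (orient-swap₂₃ (p v) (p a) (p b) (p c)) (pos⇒nonNeg vbad)))
  ... | inj₁ vcad | _         = ¬separated (follows vac) (edge vbd) vabc vcad
  ... | inj₂ _    | inj₁ vdbc = ¬separated (follows vbd) (edge vac) vbad vdbc
  -- The dependency has positive coefficients and nonnegative terms, so v, a, b, c are
  -- equally high.
  ... | inj₂ vcda | inj₂ vdcb = pos⇒≄0 vabc
    (orient-vertical (p v) (p a) (p b) (p c)
      (pos-cancel vdcb (nonNeg-sum-zeroʳ 0≤b 0≤a rest₂))
      (pos-cancel vcda (nonNeg-sum-zeroˡ 0≤b 0≤a rest₂))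
      (pos-cancel vbad (nonNeg-sum-zeroˡ 0≤c (nonNeg-+ 0≤b 0≤a) rest₁)))
    where
    0≤a = nonNeg-*-pos (top-a vab) vdcb
    0≤b = nonNeg-*-pos (top-x vab) vcda
    0≤c = nonNeg-*-pos (top-x vac) vbad
    0≤d = nonNeg-*-pos (top-x vbd) vabc
    rest₁ = nonNeg-sum-zeroʳ 0≤d (nonNeg-+ 0≤c (nonNeg-+ 0≤b 0≤a))
      (orient-dependency (p v) (p a) (p b) (p c) (p d))
    rest₂ = nonNeg-sum-zeroʳ 0≤c (nonNeg-+ 0≤b 0≤a) rest₁

  -- A mark on e: the pair (i , j) at which e is last, with the round as the side of the sum.
  Label : Subset n → Set
  Label e = ∃[ i ] ∃[ j ] ∃[ x ] e ≡ triple i j x × (Last Edge i j x ⊎ Last Inner i j x)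

  -- The triangle may be marked at (a , b) or (b , a) in the first round and at (v , a) or (v , b)
  -- in the second; `¬all-follow` excludes missing all four.
  label-top : ∀ {v a b} → Edge v a b → v ≽ a → v ≽ b → Label (triple v a b)
  label-top {v} {a} {b} vab a≼v b≼v
    with follows? edge? a b v | follows? edge? b a v
  ... | no ¬f | _ = a , b , v , triple-rotate v a b , inj₁ (rotate vab , ¬f)
  ... | yes _ | no ¬f = b , a , v , trans (triple-swap v a b) (triple-rotate v b a) ,
    inj₁ (rotate (swap vab) , ¬f)
  ... | yes abv | yes bav = go (mkInner vab abv a≼v b≼v) (mkInner (swap vab) bav b≼v a≼v)
    where
    go : Inner v a b → Inner v b a → Label (triple v a b)
    go vab vba with follows? inner? v a b | follows? inner? v b a
    ... | no ¬f | _     = v , a , b , refl , inj₂ (vab , ¬f)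
    ... | yes _ | no ¬f = v , b , a , triple-swap v a b , inj₂ (vba , ¬f)
    ... | yes f | yes g = contradiction g (¬all-follow vab f)

  -- Rotation brings a highest vertex to the front; the cyclic comparisons are settled by
  -- transitivity.
  label-edge : ∀ {i j k} → Edge i j k → Label (triple i j k)
  label-edge {i} {j} {k} ijk with ≽-total i j | ≽-total j k | ≽-total i k
  ... | inj₁ i≽j | _        | inj₁ i≽k = label-top ijk i≽j i≽k
  ... | inj₂ j≽i | inj₁ j≽k | _        =
    subst Label (sym (triple-rotate i j k)) (label-top (rotate ijk) j≽k j≽i)
  ... | inj₁ i≽j | _        | inj₂ k≽i =
    subst Label (triple-rotate k i j) (label-top (rotate (rotate ijk)) k≽i (≽-trans k≽i i≽j))
  ... | inj₂ j≽i | inj₂ k≽j | _        =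
    subst Label (triple-rotate k i j) (label-top (rotate (rotate ijk)) (≽-trans k≽j j≽i) k≽j)

  label : ∀ {e} → e ∈ˡ edges H → Label e
  label {e} e∈ =
    let i , j , k , i≢j , j≢k , i≢k , e≡ = ∣p∣≡3⇒triple e (All.lookup (edges-triples H) e∈) in
    subst Label (sym e≡) (label-edge (i≢j , j≢k , i≢k , subst (_∈ˡ edges H) e≡ e∈))

  -- The third vertex is omitted, since `last-unique` recovers it from the pair and the round. This
  -- leaves n * n * 2 codes.
  code : ∀ {e} → Label e → Fin (n ℕ.* n ℕ.* 2)
  code (i , j , _ , _ , inj₁ _) = combine (combine i j) 0F
  code (i , j , _ , _ , inj₂ _) = combine (combine i j) 1F

  code-injective : ∀ {e f} (l : Label e) (m : Label f) → code l ≡ code m → e ≡ f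
  code-injective (i , j , _ , refl , inj₁ l) (i′ , j′ , _ , refl , inj₁ m) eq
    with combine-injective (combine i j) 0F (combine i′ j′) 0F eq
  ... | eq′ , _ with combine-injective i j i′ j′ eq′
  ...   | refl , refl = cong (triple i j) (last-unique id l m)
  code-injective (i , j , _ , refl , inj₂ l) (i′ , j′ , _ , refl , inj₂ m) eq
    with combine-injective (combine i j) 1F (combine i′ j′) 1F eq
  ... | eq′ , _ with combine-injective i j i′ j′ eq′
  ...   | refl , refl = cong (triple i j) (last-unique edge l m)
  code-injective (i , j , _ , _ , inj₁ _) (i′ , j′ , _ , _ , inj₂ _) eq =
    contradiction (proj₂ (combine-injective (combine i j) 0F (combine i′ j′) 1F eq)) λ ()
  code-injective (i , j , _ , _ , inj₂ _) (i′ , j′ , _ , _ , inj₁ _) eq =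
    contradiction (proj₂ (combine-injective (combine i j) 1F (combine i′ j′) 0F eq)) λ ()

  length-bound : length (edges H) ℕ.≤ n ℕ.* n ℕ.* 2
  length-bound = injective⇒≤ {f = λ i → code (label (∈-lookup i))} λ {i} {j} eq →
    lookup-injective (edges-unique H) i j
      (code-injective (label (∈-lookup i)) (label (∈-lookup j)) eq)

-- The moment curve and the star hypergraph

fromℚ-difference : ∀ {s t} → fromℚ (s ℚ.- t) ≃ 0ℝ → s ≡ t
fromℚ-difference {s} {t} s-t≃0 = trans
  (solve 2 (λ s t → s := (s :- t) :+ t) refl s t)
  (trans (cong (ℚ._+ t) (fromℚ-injective s-t≃0)) (ℚ.+-identityˡ t))

p-q≢0 : ∀ {p q} → p ≢ q → p ℚ.- q ≢ 0ℚ
p-q≢0 {p} {q} p≢q p-q≡0 = p≢q (trans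
  (solve 2 (λ s t → s := (s :- t) :+ t) refl p q)
  (trans (cong (ℚ._+ q) p-q≡0) (ℚ.+-identityˡ q)))

moment : ℚ → ℝ³
moment t 0F = fromℚ t
moment t 1F = fromℚ (t ℚ.* t)
moment t 2F = fromℚ (t ℚ.* (t ℚ.* t))

moment-injective : ∀ {s t} → moment s ≋ moment t → s ≡ t
moment-injective {s} {t} s≋t = fromℚ-difference
  (≃-trans (pointwise λ n → solve 2 (λ s t → s :- t := s :+ con -1ℚ :* t) refl s t)
    (≃-unshift (mk≃ {fromℚ s} {fromℚ t} (s≋t 0F))))

-- Successive divided differences of t ↦ ⟨u , moment t⟩ isolate the coefficients of u.
moment-coplanar : ∀ {q r s t} → q ≢ r → q ≢ s → q ≢ t → r ≢ s → r ≢ t → s ≢ t →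
  ¬ Coplanar (moment q ∷ moment r ∷ moment s ∷ moment t ∷ [])
moment-coplanar {q} {r} {s} {t} q≢r q≢s q≢t r≢s r≢t s≢t (u , h , u≢0 , q∈ ∷ r∈ ∷ s∈ ∷ t∈ ∷ []) =
  u≢0 λ { 0F → un≃ u₀≃0 ; 1F → un≃ u₁≃0 ; 2F → un≃ u₂≃0 }
  where
  open ≃-Reasoning
  on : ∀ x → dot u (moment x) ≈ h → inner u (moment x) ≃ h
  on x = mk≃ {inner u (moment x)} {h}

  first : ℚ → ℚ → ℝ
  first x y = u 0F + (u 1F * fromℚ (x ℚ.+ y) + u 2F * fromℚ (x ℚ.* x ℚ.+ x ℚ.* y ℚ.+ y ℚ.* y))

  second : ℚ → ℚ → ℚ → ℝ
  second x y z = u 1F + u 2F * fromℚ (x ℚ.+ y ℚ.+ z)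

  first≃0 : ∀ x y → x ≢ y → inner u (moment x) ≃ h → inner u (moment y) ≃ h → first x y ≃ 0ℝ
  first≃0 x y x≢y x∈ y∈ = fromℚ-cancel (p-q≢0 x≢y) (≃-trans
    (pointwise λ n → solve 5
      (λ a b c x y → (x :- y) :* (a :+ (b :* (x :+ y) :+ c :* (x :* x :+ x :* y :+ y :* y)))
        := (a :* x :+ (b :* (x :* x) :+ (c :* (x :* (x :* x)) :+ con 0ℚ)))
          :+ con -1ℚ :* (a :* y :+ (b :* (y :* y) :+ (c :* (y :* (y :* y)) :+ con 0ℚ))))
      refl (seq (u 0F) n) (seq (u 1F) n) (seq (u 2F) n) x y)
    (≃-unshift (≃-trans x∈ (≃-sym y∈))))

  second≃0 : ∀ x y z → y ≢ z → first x y ≃ 0ℝ → first x z ≃ 0ℝ → second x y z ≃ 0ℝ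
  second≃0 x y z y≢z xy xz = fromℚ-cancel (p-q≢0 y≢z) (≃-trans
    (pointwise λ n → solve 6
      (λ a b c x y z → (y :- z) :* (b :+ c :* (x :+ y :+ z))
        := (a :+ (b :* (x :+ y) :+ c :* (x :* x :+ x :* y :+ y :* y)))
          :+ con -1ℚ :* (a :+ (b :* (x :+ z) :+ c :* (x :* x :+ x :* z :+ z :* z))))
      refl (seq (u 0F) n) (seq (u 1F) n) (seq (u 2F) n) x y z)
    (≃-unshift (≃-trans xy (≃-sym xz))))

  qr≃0 : first q r ≃ 0ℝ
  qr≃0 = first≃0 q r q≢r (on q q∈) (on r r∈)

  qrs≃0 : second q r s ≃ 0ℝ
  qrs≃0 = second≃0 q r s r≢s qr≃0 (first≃0 q s q≢s (on q q∈) (on s s∈))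

  qrt≃0 : second q r t ≃ 0ℝ
  qrt≃0 = second≃0 q r t r≢t qr≃0 (first≃0 q t q≢t (on q q∈) (on t t∈))

  u₂≃0 : u 2F ≃ 0ℝ
  u₂≃0 = fromℚ-cancel (p-q≢0 s≢t) (≃-trans
    (pointwise λ n → solve 6
      (λ b c q r s t → (s :- t) :* c
        := (b :+ c :* (q :+ r :+ s)) :+ con -1ℚ :* (b :+ c :* (q :+ r :+ t)))
      refl (seq (u 1F) n) (seq (u 2F) n) q r s t)
    (≃-unshift (≃-trans qrs≃0 (≃-sym qrt≃0))))

  u₁≃0 : u 1F ≃ 0ℝ
  u₁≃0 = begin
    u 1F
      ≈⟨ pointwise (λ n → solve 2 (λ b x → b := b :+ con 0ℚ :* x) refl
          (seq (u 1F) n) (q ℚ.+ r ℚ.+ s)) ⟩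
    u 1F + 0ℝ * fromℚ (q ℚ.+ r ℚ.+ s)
      ≈⟨ +-cong ≃-refl (*-congʳ _ u₂≃0) ⟨
    second q r s
      ≈⟨ qrs≃0 ⟩
    0ℝ ∎

  u₀≃0 : u 0F ≃ 0ℝ
  u₀≃0 = begin
    u 0F
      ≈⟨ pointwise (λ n → solve 3 (λ a x y → a := a :+ (con 0ℚ :* x :+ con 0ℚ :* y)) refl
          (seq (u 0F) n) (q ℚ.+ r) (q ℚ.* q ℚ.+ q ℚ.* r ℚ.+ r ℚ.* r)) ⟩
    u 0F + (0ℝ * fromℚ (q ℚ.+ r) + 0ℝ * fromℚ (q ℚ.* q ℚ.+ q ℚ.* r ℚ.+ r ℚ.* r))
      ≈⟨ +-cong ≃-refl (+-cong (*-congʳ _ u₁≃0) (*-congʳ _ u₂≃0)) ⟨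
    first q r
      ≈⟨ qr≃0 ⟩
    0ℝ ∎

-- Twice the signed area of a triangle in the plane.
area : ℝ → ℝ → ℝ → ℝ → ℝ → ℝ → ℝ
area x₁ y₁ x₂ y₂ x₃ y₃ = (x₂ - x₁) * (y₃ - y₁) - (x₃ - x₁) * (y₂ - y₁)

area-cong : ∀ {x₁ y₁ x₂ y₂ x₃ y₃ x₁′ y₁′ x₂′ y₂′ x₃′ y₃′} →
  x₁ ≃ x₁′ → y₁ ≃ y₁′ → x₂ ≃ x₂′ → y₂ ≃ y₂′ → x₃ ≃ x₃′ → y₃ ≃ y₃′ →
  area x₁ y₁ x₂ y₂ x₃ y₃ ≃ area x₁′ y₁′ x₂′ y₂′ x₃′ y₃′
area-cong a b c d e f =
  +-cong (*-cong (+-cong c (-‿cong a)) (+-cong f (-‿cong b)))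
    (-‿cong (*-cong (+-cong e (-‿cong a)) (+-cong d (-‿cong b))))

-- In the first two coordinates the points lie on a parabola, where `area` is, up to sign, the
-- Vandermonde product (r - s)(r - t)(s - t). On a line it is zero.
moment-collinear : ∀ {r s t} → r ≢ s → r ≢ t → s ≢ t →
  ¬ Collinear (moment r ∷ moment s ∷ moment t ∷ [])
moment-collinear {r} {s} {t} r≢s r≢t s≢t (a , d , _ , (ρ , r∈) ∷ (σ , s∈) ∷ (τ , t∈) ∷ []) =
  s≢t (fromℚ-difference (fromℚ-cancel (p-q≢0 r≢t) (fromℚ-cancel (p-q≢0 r≢s) (begin
    fromℚ (r ℚ.- s) * (fromℚ (r ℚ.- t) * fromℚ (s ℚ.- t))
      ≈⟨ pointwise (λ n → solve 3 (λ r s t → (r :- s) :* ((r :- t) :* (s :- t))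
          := con -1ℚ :* ((s :+ con -1ℚ :* r) :* (t :* t :+ con -1ℚ :* (r :* r))
            :+ con -1ℚ :* ((t :+ con -1ℚ :* r) :* (s :* s :+ con -1ℚ :* (r :* r))))) refl r s t) ⟩
    - area (moment r 0F) (moment r 1F) (moment s 0F) (moment s 1F) (moment t 0F) (moment t 1F)
      ≈⟨ -‿cong (area-cong (on r ρ r∈ 0F) (on r ρ r∈ 1F) (on s σ s∈ 0F) (on s σ s∈ 1F)
          (on t τ t∈ 0F) (on t τ t∈ 1F)) ⟩
    - area (line ρ 0F) (line ρ 1F) (line σ 0F) (line σ 1F) (line τ 0F) (line τ 1F)
      ≈⟨ neg-zero (pointwise λ n → solve 7 (λ a b c d ρ σ τ →
          let x = λ ρ → a :+ ρ :* c ; y = λ ρ → b :+ ρ :* d in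
          (x σ :+ con -1ℚ :* x ρ) :* (y τ :+ con -1ℚ :* y ρ)
            :+ con -1ℚ :* ((x τ :+ con -1ℚ :* x ρ) :* (y σ :+ con -1ℚ :* y ρ)) := con 0ℚ)
          refl (seq (a 0F) n) (seq (a 1F) n) (seq (d 0F) n) (seq (d 1F) n)
          (seq ρ n) (seq σ n) (seq τ n)) ⟩
    0ℝ ∎))))
  where
  open ≃-Reasoning
  line : ℝ → ℝ³
  line τ k = a k + τ * d k
  on : ∀ x τ → moment x ≋ line τ → ∀ k → moment x k ≃ line τ k
  on x τ x∈ k = mk≃ (x∈ k)

node : ∀ {n} → Fin n → ℚ
node i = + toℕ i ℚ./ 1

node-injective : ∀ {n} {i j : Fin n} → node i ≡ node j → i ≡ j
node-injective {i = i} {j} eq = toℕ-injective (ℤ.+-injective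
  (ℤ.*-cancelʳ-≡ (+ toℕ i) (+ toℕ j) (+ 1) (ℚᵘ.drop-*≡*
    (ℚ.fromℚᵘ-injective {mkℚᵘ (+ toℕ i) 0} {mkℚᵘ (+ toℕ j) 0} eq))))

moment-generalPosition : ∀ n → GeneralPosition {n} (moment ∘ node)
moment-generalPosition n = record
  { distinct = λ {i} {j} eq → node-injective (moment-injective {node i} {node j} eq)
  ; no-three-on-line = λ where
      i j k ((i≢j ∷ i≢k ∷ []) ∷ (j≢k ∷ []) ∷ _) →
        moment-collinear (i≢j ∘ node-injective) (i≢k ∘ node-injective) (j≢k ∘ node-injective)
  ; no-four-on-plane = λ where
      i j k l ((i≢j ∷ i≢k ∷ i≢l ∷ []) ∷ (j≢k ∷ j≢l ∷ []) ∷ (k≢l ∷ []) ∷ _) →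
        moment-coplanar (i≢j ∘ node-injective) (i≢k ∘ node-injective) (i≢l ∘ node-injective)
          (j≢k ∘ node-injective) (j≢l ∘ node-injective) (k≢l ∘ node-injective)
  }

-- Subsets of a given size

choose : ∀ (k n : ℕ) → List (Subset n)
choose zero    n       = ∅ ∷ []
choose (suc k) zero    = []
choose (suc k) (suc n) = map (inside ∷_) (choose k n) ++ map (outside ∷_) (choose (suc k) n)

choose-unique : ∀ k n → Unique (choose k n)
choose-unique zero    n       = [] ∷ []
choose-unique (suc k) zero    = []
choose-unique (suc k) (suc n) = Unique.++⁺
  (Unique.map⁺ ∷-injectiveʳ {xs = choose k n} (choose-unique k n))
  (Unique.map⁺ ∷-injectiveʳ {xs = choose (suc k) n} (choose-unique (suc k) n))
  λ (p∈ , q∈) → disjoint (∈-map⁻ (inside ∷_) {xs = choose k n} p∈)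
    (∈-map⁻ (outside ∷_) {xs = choose (suc k) n} q∈)
  where
  disjoint : ∀ {p} → ∃[ q ] q ∈ˡ choose k n × p ≡ inside ∷ q →
    ¬ (∃[ r ] r ∈ˡ choose (suc k) n × p ≡ outside ∷ r)
  disjoint (_ , _ , refl) (_ , _ , ())

size-inside : ∀ {k n} (ps : List (Subset n)) → All (λ p → ∣ p ∣ ≡ k) ps →
  All (λ p → ∣ p ∣ ≡ suc k) (map (inside ∷_) ps)
size-inside []       []         = []
size-inside (_ ∷ ps) (eq ∷ eqs) = cong suc eq ∷ size-inside ps eqs

size-outside : ∀ {k n} (ps : List (Subset n)) → All (λ p → ∣ p ∣ ≡ k) ps →
  All (λ p → ∣ p ∣ ≡ k) (map (outside ∷_) ps)
size-outside []       []         = []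
size-outside (_ ∷ ps) (eq ∷ eqs) = eq ∷ size-outside ps eqs

choose-size : ∀ k n → All (λ p → ∣ p ∣ ≡ k) (choose k n)
choose-size zero    n       = ∣⊥∣≡0 n ∷ []
choose-size (suc k) zero    = []
choose-size (suc k) (suc n) = All.++⁺ (size-inside (choose k n) (choose-size k n))
  (size-outside (choose (suc k) n) (choose-size (suc k) n))

length-choose-suc : ∀ k n →
  length (choose (suc k) (suc n)) ≡ length (choose k n) ℕ.+ length (choose (suc k) n)
length-choose-suc k n = trans (length-++ (map (inside ∷_) (choose k n)))
  (cong₂ ℕ._+_ (length-map _ (choose k n)) (length-map _ (choose (suc k) n)))

length-choose₁ : ∀ n → length (choose 1 n) ≡ n
length-choose₁ zero    = refl
length-choose₁ (suc n) = trans (length-choose-suc 0 n) (cong suc (length-choose₁ n))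

-- The count n (n - 1) / 2, cleared of subtraction and division.
length-choose₂ : ∀ n → 2 ℕ.* length (choose 2 n) ℕ.+ n ≡ n ℕ.* n
length-choose₂ zero    = refl
length-choose₂ (suc n) = trans
  (cong (λ l → 2 ℕ.* l ℕ.+ suc n)
    (trans (length-choose-suc 1 n) (cong (ℕ._+ length (choose 2 n)) (length-choose₁ n))))
  (trans (regroup (length (choose 2 n)) n)
    (trans (cong (ℕ._+ suc (n ℕ.+ n)) (length-choose₂ n)) (square n)))
  where
  regroup : ∀ l n → 2 ℕ.* (n ℕ.+ l) ℕ.+ suc n ≡ (2 ℕ.* l ℕ.+ n) ℕ.+ suc (n ℕ.+ n)
  regroup = solve-∀
  square : ∀ n → n ℕ.* n ℕ.+ suc (n ℕ.+ n) ≡ suc n ℕ.* suc n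
  square = solve-∀

-- With n = 3 + k, the right side is 8 (n - 1)(n - 2), which exceeds n² by 7k² + 18k + 7.
n²≤16*length-choose₂ : ∀ k → (3 ℕ.+ k) ℕ.^ 2 ℕ.≤ length (choose 2 (2 ℕ.+ k)) ℕ.* 16
n²≤16*length-choose₂ k = ℕ.≤-trans (ℕ.m≤m+n _ (7 ℕ.* (k ℕ.* k) ℕ.+ 18 ℕ.* k ℕ.+ 7))
  -- Adding 8 (2 + k) to both sides brings them to 8 times the identity `length-choose₂`.
  (ℕ.≤-reflexive (ℕ.+-cancelʳ-≡ (8 ℕ.* (2 ℕ.+ k)) _ _ (trans (expand k)
    (trans (cong (8 ℕ.*_) (sym (length-choose₂ (2 ℕ.+ k))))
      (regroup (length (choose 2 (2 ℕ.+ k))) (2 ℕ.+ k))))))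
  where
  expand : ∀ k → (3 ℕ.+ k) ℕ.* ((3 ℕ.+ k) ℕ.* 1) ℕ.+ (7 ℕ.* (k ℕ.* k) ℕ.+ 18 ℕ.* k ℕ.+ 7)
    ℕ.+ 8 ℕ.* (2 ℕ.+ k) ≡ 8 ℕ.* ((2 ℕ.+ k) ℕ.* (2 ℕ.+ k))
  expand = solve-∀
  regroup : ∀ l m → 8 ℕ.* (2 ℕ.* l ℕ.+ m) ≡ l ℕ.* 16 ℕ.+ 8 ℕ.* m
  regroup = solve-∀

-- Triangles through a common vertex

vertex∈hull : ∀ {n} (p : Vector ℝ³ (suc n)) S → ConvexHull p (inside ∷ S) (p zero)
vertex∈hull {n} p S = w , 0≤w , off , un≃ total , λ k → un≃ (barycentre k)
  where
  w : Vector ℝ (suc n)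
  w = 1ℝ ∷ᵛ λ _ → 0ℝ
  0≤w : ∀ i → 0ℝ ≤ w i
  0≤w zero    = unNonNeg (pos⇒nonNeg
    (pos-intro {1ℝ} ½ (ℚ.positive⁻¹ ½) (0 , λ _ _ → ℚ.positive⁻¹ ½)))
  0≤w (suc i) = unNonNeg (nonNeg-0 (≃-refl {0ℝ}))
  off : ∀ i → i ∉ (inside ∷ S) → w i ≈ 0ℝ
  off zero    0∉ = contradiction here 0∉
  off (suc i) _  = un≃ (≃-refl {0ℝ})
  total : sum w ≃ 1ℝ
  total = ≃-trans (+-cong ≃-refl (sum-zero {v = λ (_ : Fin n) → 0ℝ} λ _ → ≃-refl))
    (pointwise λ _ → refl)
  barycentre : ∀ k → p zero k ≃ sum (λ i → w i * p i k)
  barycentre k = ≃-sym (≃-trans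
    (+-cong ≃-refl (sum-zero {v = λ i → 0ℝ * p (suc i) k} λ i → zeroˡ (p (suc i) k)))
    (pointwise λ n → solve 1 (λ x → con 1ℚ :* x :+ con 0ℚ := x) refl (seq (p zero k) n)))

star : ∀ n → GeometricHypergraph (suc n)
star n = record
  { point            = moment ∘ node
  ; general-position = moment-generalPosition (suc n)
  ; edges            = map (inside ∷_) (choose 2 n)
  ; edges-unique     = Unique.map⁺ ∷-injectiveʳ {xs = choose 2 n} (choose-unique 2 n)
  ; edges-triples    = size-inside (choose 2 n) (choose-size 2 n)
  }

star-intersecting : ∀ n → ¬ HasTwoDisjointEdges (star n)
star-intersecting n (e , f , e∈ , f∈ , disjoint)
  with ∈-map⁻ (inside ∷_) {xs = choose 2 n} e∈ | ∈-map⁻ (inside ∷_) {xs = choose 2 n} f∈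
... | S , _ , refl | T , _ , refl =
  disjoint (point (star n) zero) (vertex∈hull (point (star n)) S , vertex∈hull (point (star n)) T)

-- The extremal number

-- Double negation commutes with finite conjunctions, so finitely many sign decisions can be assumed
-- together.
¬¬-∀ : ∀ {n} {P : Fin n → Set} → (∀ i → ¬ ¬ P i) → ¬ ¬ (∀ i → P i)
¬¬-∀ {zero}  ¬¬P ¬∀ = ¬∀ λ ()
¬¬-∀ {suc n} ¬¬P ¬∀ = ¬¬P zero λ p₀ → ¬¬-∀ (¬¬P ∘ suc) λ ps → ¬∀ (∀-cons p₀ ps)

upper-bound : ∀ {n} (H : GeometricHypergraph n) → ¬ HasTwoDisjointEdges H →
  length (edges H) ℕ.≤ n ℕ.* n ℕ.* 2
upper-bound H ¬disjoint = decidable-stable (_ ℕ.≤? _) λ ≰ →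
  ¬¬-∀ (λ i → ¬¬-∀ λ j → ¬¬-∀ λ k → ¬¬-∀ λ l → ¬¬-excluded-middle) λ pos? →
  ¬¬-∀ (λ i → ¬¬-∀ λ j → ¬¬-excluded-middle) λ below? →
  ≰ (UpperBound.length-bound H ¬disjoint pos? below?)

-- Induction on the slack b between an attained value k and the bound k + b. Either a larger value
-- is attained, which shrinks the slack, or k is the maximum; this case distinction is available
-- under the double negation.
maximum-exists : ∀ {P : ℕ → Set} b {k} → P k → (∀ j → P j → j ℕ.≤ k ℕ.+ b) →
  ¬ ¬ (∃[ m ] IsMaximum P m)
maximum-exists zero {k} Pk bound ¬max =
  ¬max (k , Pk , λ j Pj → ℕ.≤-trans (bound j Pj) (ℕ.≤-reflexive (ℕ.+-identityʳ k)))
maximum-exists {P} (suc b) {k} Pk bound ¬max = ¬¬-excluded-middle {A = ∃[ j ] P j × k ℕ.< j} λ where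
  (yes (j , Pj , k<j)) → maximum-exists b Pj
    (λ i Pi → ℕ.≤-trans (bound i Pi)
      (ℕ.≤-trans (ℕ.≤-reflexive (ℕ.+-suc k b)) (ℕ.+-monoˡ-≤ b k<j))) ¬max
  (no ¬larger) → ¬max (k , Pk , λ j Pj → ℕ.≮⇒≥ λ k<j → ¬larger (j , Pj , k<j))

-- Rational bounds read as bounds between reals

pointwise-≤ : ∀ {x y} → (∀ n → seq x n ℚ.≤ seq y n) → x ≤ y
pointwise-≤ {x} {y} x≤y ε 0<ε = 0 , λ n _ → ℚ.≤-<-trans (x≤y n)
  (ℚ.≤-<-trans (ℚ.≤-reflexive (sym (ℚ.+-identityʳ (seq y n)))) (ℚ.+-monoʳ-< (seq y n) 0<ε))

-- `mkℚᵘ` stores the denominator minus one, so `mkℚᵘ (+ a) d` is the fraction with denominator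
-- `suc d`.
toℚᵘ-/ : ∀ a d → ℚ.toℚᵘ (+ a ℚ./ suc d) ℚᵘ.≃ mkℚᵘ (+ a) d
toℚᵘ-/ a d = ℚ.toℚᵘ-fromℚᵘ (mkℚᵘ (+ a) d)

toℚᵘ-/-* : ∀ a d b → ℚ.toℚᵘ ((+ a ℚ./ suc d) ℚ.* (+ b ℚ./ 1)) ℚᵘ.≃ mkℚᵘ (+ a) d ℚᵘ.* mkℚᵘ (+ b) 0
toℚᵘ-/-* a d b = ℚᵘ.≃-trans (ℚ.toℚᵘ-homo-* (+ a ℚ./ suc d) (+ b ℚ./ 1))
  (ℚᵘ.*-cong (toℚᵘ-/ a d) (toℚᵘ-/ b 0))

-- For unnormalised rationals the order is cross-multiplication by definition, so the claim becomes
-- the given inequality of naturals.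
fraction-≤ : ∀ a d b k → a ℕ.* b ℕ.≤ k ℕ.* suc d → (+ a ℚ./ suc d) ℚ.* (+ b ℚ./ 1) ℚ.≤ + k ℚ./ 1
fraction-≤ a d b k h = ℚ.toℚᵘ-cancel-≤ (ℚᵘ.≤-respˡ-≃ (ℚᵘ.≃-sym (toℚᵘ-/-* a d b))
  (ℚᵘ.≤-respʳ-≃ (ℚᵘ.≃-sym (toℚᵘ-/ k 0)) (*≤* (subst₂ ℤ._≤_
    (trans (ℤ.pos-* a b) (sym (ℤ.*-identityʳ (+ a ℤ.* + b))))
    (trans (ℤ.pos-* k (suc d)) (cong (λ e → + k ℤ.* + e) (sym (ℕ.*-identityʳ (suc d)))))
    (ℤ.+≤+ h)))))

≤-fraction : ∀ a b k → k ℕ.≤ a ℕ.* b → + k ℚ./ 1 ℚ.≤ (+ a ℚ./ 1) ℚ.* (+ b ℚ./ 1)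
≤-fraction a b k h = ℚ.toℚᵘ-cancel-≤ (ℚᵘ.≤-respˡ-≃ (ℚᵘ.≃-sym (toℚᵘ-/ k 0))
  (ℚᵘ.≤-respʳ-≃ (ℚᵘ.≃-sym (toℚᵘ-/-* a 0 b)) (*≤* (subst₂ ℤ._≤_
    (sym (ℤ.*-identityʳ (+ k)))
    (trans (ℤ.pos-* a b) (sym (ℤ.*-identityʳ (+ a ℤ.* + b))))
    (ℤ.+≤+ h)))))

fromℚ-pos : ∀ q → .{{ℚ.Positive q}} → 0ℝ < fromℚ q
fromℚ-pos q = half q , 0<half (ℚ.positive⁻¹ q) , 0 , λ _ _ → 0<q-p⇒p<q (subst (0ℚ ℚ.<_)
  (solve 1 (λ q → con ½ :* q := q :- (con 0ℚ :+ con ½ :* q)) refl q) (0<half (ℚ.positive⁻¹ q)))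

theorem1p5 : Σ[ c ∈ ℝ ] Σ[ C ∈ ℝ ] Σ[ n₀ ∈ ℕ ] 0ℝ < c × 0ℝ < C ×
    (∀ n → n₀ ℕ.≤ n →
    ¬ ¬ (∃[ m ] Isex₃D₂ n m) ×
    (∀ m → Isex₃D₂ n m →
    c * fromℕ (n ℕ.^ 2) ≤ fromℕ m × fromℕ m ≤ C * fromℕ (n ℕ.^ 2)))
-- The constant 1/16 comes from the star, and 2 from two rounds of marks over the ordered pairs.
-- From 3 vertices on, the star has an edge.
theorem1p5 = fromℚ (+ 1 ℚ./ 16) , fromℕ 2 , 3 ,
  fromℚ-pos (+ 1 ℚ./ 16) , fromℚ-pos (+ 2 ℚ./ 1) , λ where
  1 (s≤s ())
  2 (s≤s (s≤s ()))
  n@(suc m@(suc (suc k))) _ →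
    -- `star m` has n vertices, as m counts those other than the centre. Its edge count is the
    -- initial attained value, and the upper bound itself serves as slack.
    maximum-exists (n ℕ.* n ℕ.* 2) (star m , star-intersecting m , refl)
      (λ { _ (H , ¬disjoint , refl) →
        ℕ.≤-trans (upper-bound H ¬disjoint) (ℕ.m≤n+m _ (length (edges (star m)))) }) ,
    λ { _ ((H , ¬disjoint , refl) , max) →
      pointwise-≤ {fromℚ (+ 1 ℚ./ 16) * fromℕ (n ℕ.^ 2)} {fromℕ (length (edges H))}
        (λ _ → fraction-≤ 1 15 (n ℕ.^ 2) (length (edges H))
        (ℕ.≤-trans (ℕ.≤-reflexive (ℕ.*-identityˡ (n ℕ.^ 2)))
          (ℕ.≤-trans (n²≤16*length-choose₂ k) (ℕ.*-monoˡ-≤ 16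
            (ℕ.≤-trans (ℕ.≤-reflexive (sym (length-map (inside ∷_) (choose 2 m))))
              (max _ (star m , star-intersecting m , refl))))))) ,
      pointwise-≤ {fromℕ (length (edges H))} {fromℕ 2 * fromℕ (n ℕ.^ 2)}
        (λ _ → ≤-fraction 2 (n ℕ.^ 2) (length (edges H))
        (ℕ.≤-trans (upper-bound H ¬disjoint) (ℕ.≤-reflexive
          (trans (ℕ.*-comm (n ℕ.* n) 2) (cong (λ l → 2 ℕ.* (n ℕ.* l)) (sym (ℕ.*-identityʳ n))))))) }
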